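{- For $n\ge 1$ let $$A_n(s,t)=\sum_{\pi\in\mathfrak{S}_n}s^{\mathrm{des}(\pi)}t^{\mathrm{exc}(\pi)},\qquad a_n(s,t)=\frac{A_n(s,t)-t^nA_n(s,1/t)}{1-t},$$ and set $a_0(s,t)=0$. Then for every $n\ge 1$, $a_n(s,t)$ is a $t$-symmetric polynomial, i.e. $a_n(s,t)\in\mathbb{Z}[s,t]$ and $t^{n-1}a_n(s,1/t)=a_n(s,t)$, and $A_n(s,t)$ has the $t$-symmetric decomposition $$A_n(s,t)=a_n(s,t)+(s-1)\,t\,a_{n-1}(s,t).$$
   Context: $\mathfrak{S}_n$ is the set of permutations $\pi=\pi(1)\cdots\pi(n)$ of $[n]=\{1,\dots,n\}$. $\mathrm{des}(\pi)$ is the number of descents of $\pi$, i.e. of indices $i\in\{1,\dots,n-1\}$ with $\pi(i)>\pi(i+1)$. $\mathrm{exc}(\pi)$ is the number of excedances of $\pi$, i.e. of indices $i\in\{1,\dots,n\}$ with $\pi(i)>i$. As a polynomial in $t$, $A_n(s,t)$ has degree $n-1$. A $t$-symmetric decomposition of $A_n(s,t)$ is an expression $A_n(s,t)=a(s,t)+t\,b(s,t)$ with polynomials $a,b$ satisfying $t^{n-1}a(s,1/t)=a(s,t)$ and $t^{n-2}b(s,1/t)=b(s,t)$. Here $a=a_n$ and $b=(s-1)a_{n-1}$. -}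

module Defs where

open import Data.Fin.Base as Fin using (Fin; suc; inject₁)
import Data.Fin.Properties as Fin
open import Data.Integer.Base as ℤ using (ℤ; 0ℤ; 1ℤ; +_; -[1+_])
import Data.Integer.Properties as ℤ
open import Algebra.Properties.AbelianGroup ℤ.+-0-abelianGroup
  using (xyx⁻¹≈y)
open import Data.List.Base as List using (List; []; _∷_; [_]; _++_; map; foldr; filter; cartesianProductWith)
open import Data.List.Properties using (++-assoc; map-++; map-∘; map-cong; map-id)
open import Data.Nat.Base as ℕ using (ℕ; zero; suc)
open import Data.Product using (∃-syntax; _×_; _,_; proj₁; proj₂)
open import Data.Vec.Base using (Vec; []; _∷_; lookup; allFin; count)
open import Data.Vec.Relation.Unary.AllPairs using (allPairs?)
open import Data.Vec.Relation.Unary.Unique.Propositional using (Unique)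
open import Relation.Binary.PropositionalEquality
  using (_≡_; _≢_; refl; sym; trans; cong; cong₂; subst; module ≡-Reasoning)
open import Relation.Nullary using (Dec; yes; no; ¬?; contradiction; _×-dec_)

------------------------------------------------------------------------
-- Permutations in one-line notation, with [n] = {1,…,n} encoded as Fin n
-- by i ↦ i - 1 (positions and values alike)

words : (k n : ℕ) → List (Vec (Fin k) n)
words k zero    = [ [] ]
words k (suc n) = cartesianProductWith _∷_ (List.allFin k) (words k n)

unique? : ∀ {k n} (w : Vec (Fin k) n) → Dec (Unique w)
unique? = allPairs? (λ x y → ¬? (x Fin.≟ y))

𝔖 : (n : ℕ) → List (Vec (Fin n) n)
𝔖 n = filter unique? (words n n)

des : ∀ {n} → Vec (Fin n) n → ℕ
des {zero}  π = 0
des {suc m} π = count (λ i → lookup π (suc i) Fin.<? lookup π (inject₁ i)) (allFin m)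

exc : ∀ {n} → Vec (Fin n) n → ℕ
exc {n} π = count (λ i → i Fin.<? lookup π i) (allFin n)

------------------------------------------------------------------------
-- Laurent polynomials ℤ[s,s⁻¹,t,t⁻¹]: formal sums of terms, the triple
-- (c , i , j) being c sⁱ tʲ, compared by their coefficients

Term : Set
Term = ℤ × ℤ × ℤ

Laurent : Set
Laurent = List Term

coeffₜ : Term → ℤ → ℤ → ℤ
coeffₜ (c , a , b) i j with a ℤ.≟ i ×-dec b ℤ.≟ j
... | yes _ = c
... | no  _ = 0ℤ

coeff : Laurent → ℤ → ℤ → ℤ
coeff []      i j = 0ℤ
coeff (m ∷ p) i j = coeffₜ m i j ℤ.+ coeff p i j

infix 4 _≈_
_≈_ : Laurent → Laurent → Set
p ≈ q = ∀ i j → coeff p i j ≡ coeff q i j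

infixl 6 _+_ _-_
infixl 7 _*_ _·_ _*ₜ_
infix  8 -_

0# 1# s t : Laurent
0# = []
1# = [ 1ℤ , 0ℤ , 0ℤ ]
s  = [ 1ℤ , 1ℤ , 0ℤ ]
t  = [ 1ℤ , 0ℤ , 1ℤ ]

s^_ t^_ : ℤ → Laurent
s^ k = [ 1ℤ , k , 0ℤ ]
t^ k = [ 1ℤ , 0ℤ , k ]

_+_ : Laurent → Laurent → Laurent
_+_ = _++_

-_ : Laurent → Laurent
- p = map (λ (c , a , b) → ℤ.- c , a , b) p

_-_ : Laurent → Laurent → Laurent
p - q = p + - q

_*ₜ_ : Term → Term → Term
(c , a , b) *ₜ (c′ , a′ , b′) = c ℤ.* c′ , a ℤ.+ a′ , b ℤ.+ b′

_·_ : Term → Laurent → Laurent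
m · p = map (m *ₜ_) p

_*_ : Laurent → Laurent → Laurent
[]      * q = []
(m ∷ p) * q = m · q + p * q

sum : List Laurent → Laurent
sum = foldr _+_ 0#

invₜ : Term → Term
invₜ (c , a , b) = c , a , ℤ.- b

-- p(s,1/t)
_[1/t] : Laurent → Laurent
p [1/t] = map invₜ p

-- p ∈ ℤ[s,t]
IsPolynomial : Laurent → Set
IsPolynomial p = ∀ i j → coeff p i j ≢ 0ℤ → 0ℤ ℤ.≤ i × 0ℤ ℤ.≤ j

------------------------------------------------------------------------
-- Regular elements, i.e. non-zero-divisors

Regular : Laurent → Set
Regular d = ∀ f → d * f ≈ 0# → f ≈ 0#

coeff-+ : ∀ p q i j → coeff (p + q) i j ≡ coeff p i j ℤ.+ coeff q i j
coeff-+ []      q i j = sym (ℤ.+-identityˡ _)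
coeff-+ (m ∷ p) q i j =
  trans (cong (ℤ._+_ (coeffₜ m i j)) (coeff-+ p q i j)) (sym (ℤ.+-assoc (coeffₜ m i j) _ _))

private
  shift : ∀ a a′ i → a ℤ.+ a′ ≡ i → a′ ≡ i ℤ.- a
  shift a a′ i refl = sym (xyx⁻¹≈y a a′)

  unshift : ∀ a a′ i → a′ ≡ i ℤ.- a → a ℤ.+ a′ ≡ i
  unshift a a′ i refl = trans (sym (ℤ.+-assoc a i (ℤ.- a))) (xyx⁻¹≈y a i)

coeff-*ₜ : ∀ c a b m i j →
  coeffₜ ((c , a , b) *ₜ m) i j ≡ c ℤ.* coeffₜ m (i ℤ.- a) (j ℤ.- b)
coeff-*ₜ c a b (c′ , a′ , b′) i j
  with a ℤ.+ a′ ℤ.≟ i ×-dec b ℤ.+ b′ ℤ.≟ j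
     | a′ ℤ.≟ i ℤ.- a ×-dec b′ ℤ.≟ j ℤ.- b
... | yes _       | yes _       = refl
... | no  _       | no  _       = sym (ℤ.*-zeroʳ c)
... | yes (p , q) | no  ¬r      = contradiction (shift a a′ i p , shift b b′ j q) ¬r
... | no  ¬r      | yes (p , q) = contradiction (unshift a a′ i p , unshift b b′ j q) ¬r

coeff-· : ∀ c a b p i j →
  coeff ((c , a , b) · p) i j ≡ c ℤ.* coeff p (i ℤ.- a) (j ℤ.- b)
coeff-· c a b []      i j = sym (ℤ.*-zeroʳ c)
coeff-· c a b (m ∷ p) i j =
  trans (cong₂ ℤ._+_ (coeff-*ₜ c a b m i j) (coeff-· c a b p i j))
        (sym (ℤ.*-distribˡ-+ c (coeffₜ m (i ℤ.- a) (j ℤ.- b)) _))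

coeff-invₜ : ∀ m i j → coeffₜ (invₜ m) i j ≡ coeffₜ m i (ℤ.- j)
coeff-invₜ (c , a , b) i j with a ℤ.≟ i ×-dec ℤ.- b ℤ.≟ j | a ℤ.≟ i ×-dec b ℤ.≟ ℤ.- j
... | yes _       | yes _       = refl
... | no  _       | no  _       = refl
... | yes (p , q) | no  ¬r      =
  contradiction (p , trans (sym (ℤ.neg-involutive b)) (cong ℤ.-_ q)) ¬r
... | no  ¬r      | yes (p , q) =
  contradiction (p , trans (cong ℤ.-_ q) (ℤ.neg-involutive j)) ¬r

coeff-inv : ∀ p i j → coeff (p [1/t]) i j ≡ coeff p i (ℤ.- j)
coeff-inv []      i j = refl
coeff-inv (m ∷ p) i j = cong₂ ℤ._+_ (coeff-invₜ m i j) (coeff-inv p i j)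

*ₜ-assoc : ∀ m m′ m″ → (m *ₜ m′) *ₜ m″ ≡ m *ₜ (m′ *ₜ m″)
*ₜ-assoc (c , a , b) (c′ , a′ , b′) (c″ , a″ , b″) =
  cong₂ _,_ (ℤ.*-assoc c c′ c″) (cong₂ _,_ (ℤ.+-assoc a a′ a″) (ℤ.+-assoc b b′ b″))

*-distribʳ-+ : ∀ r p q → (p + q) * r ≡ p * r + q * r
*-distribʳ-+ r []      q = refl
*-distribʳ-+ r (m ∷ p) q =
  trans (cong (_+_ (m · r)) (*-distribʳ-+ r p q)) (sym (++-assoc (m · r) (p * r) (q * r)))

·-*-assoc : ∀ m p q → (m · p) * q ≡ m · (p * q)
·-*-assoc m []       q = refl
·-*-assoc m (m′ ∷ p) q =
  trans (cong₂ _+_ (trans (map-cong (*ₜ-assoc m m′) q) (map-∘ q)) (·-*-assoc m p q))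
        (sym (map-++ (m *ₜ_) (m′ · q) (p * q)))

*-assoc : ∀ p q r → (p * q) * r ≡ p * (q * r)
*-assoc []      q r = refl
*-assoc (m ∷ p) q r =
  trans (*-distribʳ-+ r (m · q) (p * q)) (cong₂ _+_ (·-*-assoc m q r) (*-assoc p q r))

inv-· : ∀ m p → (m · p) [1/t] ≡ invₜ m · (p [1/t])
inv-· m@(c , a , b) p = trans (sym (map-∘ p)) (trans (map-cong lem p) (map-∘ p))
  where
  lem : ∀ m′ → invₜ (m *ₜ m′) ≡ invₜ m *ₜ invₜ m′
  lem (c′ , a′ , b′) = cong (λ k → _ , _ , k) (ℤ.neg-distrib-+ b b′)

inv-* : ∀ p q → (p * q) [1/t] ≡ p [1/t] * q [1/t]
inv-* []      q = refl
inv-* (m ∷ p) q =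
  trans (map-++ invₜ (m · q) (p * q)) (cong₂ _+_ (inv-· m q) (inv-* p q))

inv-involutive : ∀ p → p [1/t] [1/t] ≡ p
inv-involutive p = trans (sym (map-∘ p)) (trans (map-cong lem p) (map-id p))
  where
  lem : ∀ m → invₜ (invₜ m) ≡ m
  lem (c , a , b) = cong (λ k → c , a , k) (ℤ.neg-involutive b)

inv-≈0 : ∀ p → p ≈ 0# → p [1/t] ≈ 0#
inv-≈0 p p≈0 i j = trans (coeff-inv p i j) (p≈0 i (ℤ.- j))

regular-1 : Regular 1#
regular-1 f 1f≈0 i j = begin
  coeff f i j
    ≡⟨ cong₂ (coeff f) (ℤ.+-identityʳ i) (ℤ.+-identityʳ j) ⟨
  coeff f (i ℤ.- 0ℤ) (j ℤ.- 0ℤ)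
    ≡⟨ ℤ.*-identityˡ _ ⟨
  1ℤ ℤ.* coeff f (i ℤ.- 0ℤ) (j ℤ.- 0ℤ)
    ≡⟨ coeff-· 1ℤ 0ℤ 0ℤ f i j ⟨
  coeff ((1ℤ , 0ℤ , 0ℤ) · f) i j
    ≡⟨ ℤ.+-identityʳ _ ⟨
  coeff ((1ℤ , 0ℤ , 0ℤ) · f) i j ℤ.+ 0ℤ
    ≡⟨ coeff-+ ((1ℤ , 0ℤ , 0ℤ) · f) [] i j ⟨
  coeff (1# * f) i j
    ≡⟨ 1f≈0 i j ⟩
  0ℤ ∎
  where open ≡-Reasoning

regular-* : ∀ {d e} → Regular d → Regular e → Regular (d * e)
regular-* {d} {e} rd re f def≈0 = re f (rd (e * f) (subst (_≈ 0#) (*-assoc d e f) def≈0))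

regular-inv : ∀ {d} → Regular d → Regular (d [1/t])
regular-inv {d} rd f h =
  subst (_≈ 0#) (inv-involutive f) (inv-≈0 (f [1/t]) (rd (f [1/t])
    (subst (_≈ 0#) (trans (inv-* (d [1/t]) f) (cong (_* f [1/t]) (inv-involutive d)))
      (inv-≈0 (d [1/t] * f) h))))

-- If (1 - t) f = 0, the coefficients of f do not depend on the exponent
-- of t, and those of low enough exponent vanish.
regular-1-t : Regular (1# - t)
regular-1-t f h i j = trans (sym (back k j)) (proj₂ (low f) (j ℤ.- + k) below)
  where
  open ≡-Reasoning

  coeff-[1-t] : ∀ j → coeff ((1# - t) * f) i j ≡ coeff f i j ℤ.- coeff f i (ℤ.pred j)
  coeff-[1-t] j = begin
    coeff ((1# - t) * f) i j
      ≡⟨ coeff-+ (u · f) (v · f + []) i j ⟩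
    coeff (u · f) i j ℤ.+ coeff (v · f + []) i j
      ≡⟨ cong (ℤ._+_ (coeff (u · f) i j)) (trans (coeff-+ (v · f) [] i j) (ℤ.+-identityʳ _)) ⟩
    coeff (u · f) i j ℤ.+ coeff (v · f) i j
      ≡⟨ cong₂ ℤ._+_ (coeff-· 1ℤ 0ℤ 0ℤ f i j) (coeff-· ℤ.-1ℤ 0ℤ 1ℤ f i j) ⟩
    1ℤ ℤ.* coeff f (i ℤ.- 0ℤ) (j ℤ.- 0ℤ) ℤ.+ ℤ.-1ℤ ℤ.* coeff f (i ℤ.- 0ℤ) (j ℤ.- 1ℤ)
      ≡⟨ cong₂ ℤ._+_ (ℤ.*-identityˡ (coeff f (i ℤ.- 0ℤ) (j ℤ.- 0ℤ)))
                     (ℤ.-1*i≡-i (coeff f (i ℤ.- 0ℤ) (j ℤ.- 1ℤ))) ⟩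
    coeff f (i ℤ.- 0ℤ) (j ℤ.- 0ℤ) ℤ.- coeff f (i ℤ.- 0ℤ) (j ℤ.- 1ℤ)
      ≡⟨ cong₂ (λ x y → x ℤ.- y)
           (cong₂ (coeff f) (ℤ.+-identityʳ i) (ℤ.+-identityʳ j))
           (cong₂ (coeff f) (ℤ.+-identityʳ i) (ℤ.+-comm j ℤ.-1ℤ)) ⟩
    coeff f i j ℤ.- coeff f i (ℤ.pred j) ∎
    where
    u = 1ℤ , 0ℤ , 0ℤ
    v = ℤ.-1ℤ , 0ℤ , 1ℤ

  step : ∀ j → coeff f i (ℤ.pred j) ≡ coeff f i j
  step j = sym (ℤ.i-j≡0⇒i≡j _ _ (trans (sym (coeff-[1-t] j)) (h i j)))

  back : ∀ k j → coeff f i (j ℤ.- + k) ≡ coeff f i j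
  back zero    j = cong (coeff f i) (ℤ.+-identityʳ j)
  back (suc k) j = trans (cong (coeff f i) (ℤ.minus-suc j k)) (trans (step _) (back k j))

  low : ∀ f → ∃[ N ] (∀ j → j ℤ.< N → coeff f i j ≡ 0ℤ)
  low []                = 0ℤ , λ _ _ → refl
  low ((c , a , b) ∷ f) with low f
  ... | N , vanish = b ℤ.⊓ N , λ j j<bN →
    cong₂ ℤ._+_ (term j (ℤ.<-≤-trans j<bN (ℤ.i⊓j≤i b N)))
                (vanish j (ℤ.<-≤-trans j<bN (ℤ.i⊓j≤j b N)))
    where
    term : ∀ j → j ℤ.< b → coeffₜ (c , a , b) i j ≡ 0ℤ
    term j j<b with a ℤ.≟ i ×-dec b ℤ.≟ j
    ... | yes (_ , b≡j) = contradiction j<b (ℤ.<-irrefl (sym b≡j))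
    ... | no  _         = refl

  N = proj₁ (low f)
  k = suc ℤ.∣ j ℤ.- N ∣

  below : j ℤ.- + k ℤ.< N
  below = subst (ℤ._< N) (sym (ℤ.minus-suc j ℤ.∣ j ℤ.- N ∣)) (ℤ.<-≤-trans (ℤ.i≤pred[j]⇒i<j ℤ.≤-refl) le)
    where
    i≤∣i∣ : ∀ i → i ℤ.≤ + ℤ.∣ i ∣
    i≤∣i∣ (+ n)    = ℤ.≤-refl
    i≤∣i∣ -[1+ n ] = ℤ.-≤+
    le : j ℤ.- + ℤ.∣ j ℤ.- N ∣ ℤ.≤ N
    le = ℤ.≤-trans (ℤ.+-monoʳ-≤ j (ℤ.neg-mono-≤ (i≤∣i∣ (j ℤ.- N))))
           (ℤ.≤-reflexive (begin
             j ℤ.- (j ℤ.- N)          ≡⟨ cong (ℤ._+_ j) (ℤ.neg-distrib-+ j (ℤ.- N)) ⟩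
             j ℤ.+ (ℤ.- j ℤ.- ℤ.- N)  ≡⟨ ℤ.+-assoc j (ℤ.- j) _ ⟨
             j ℤ.- j ℤ.- ℤ.- N        ≡⟨ cong₂ ℤ._+_ (ℤ.+-inverseʳ j) (ℤ.neg-involutive N) ⟩
             0ℤ ℤ.+ N                 ≡⟨ ℤ.+-identityˡ N ⟩
             N                        ∎))

------------------------------------------------------------------------
-- Rational functions, as the total ring of fractions of ℤ[s,s⁻¹,t,t⁻¹].
-- That ring is an integral domain, so the regular elements are the
-- nonzero ones and this is the field ℚ(s,t).

infix 7 _/_[_]
record Rational : Set where
  constructor _/_[_]
  field
    num     : Laurent
    den     : Laurent
    regular : Regular den

open Rational public

infix 4 _≃_
_≃_ : Rational → Rational → Set
f ≃ g = num f * den g ≈ num g * den f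

ι : Laurent → Rational
ι p = p / 1# [ regular-1 ]

infixl 6 _+ᶠ_
_+ᶠ_ : Rational → Rational → Rational
(p / d [ rd ]) +ᶠ (q / e [ re ]) = (p * e + q * d) / d * e [ regular-* {d} {e} rd re ]

infixl 7 _*ᶠ_
_*ᶠ_ : Rational → Rational → Rational
(p / d [ rd ]) *ᶠ (q / e [ re ]) = (p * q) / d * e [ regular-* {d} {e} rd re ]

-- f(s,1/t)
_[1/t]ᶠ : Rational → Rational
(p / d [ rd ]) [1/t]ᶠ = (p [1/t]) / d [1/t] [ regular-inv {d} rd ]

IsPolynomialᶠ : Rational → Set
IsPolynomialᶠ f = ∃[ p ] IsPolynomial p × f ≃ ι p

------------------------------------------------------------------------
-- t-symmetry

-- tᵏ f(s,1/t) = f(s,t)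
TSymmetric : ℤ → Rational → Set
TSymmetric k f = ι (t^ k) *ᶠ f [1/t]ᶠ ≃ f

-- F = f + t g, where F is regarded as having degree n - 1 in t
record TSymmetricDecomposition (n : ℕ) (F f g : Rational) : Set where
  field
    f-polynomial : IsPolynomialᶠ f
    f-symmetric  : TSymmetric (+ n ℤ.- + 1) f
    g-polynomial : IsPolynomialᶠ g
    g-symmetric  : TSymmetric (+ n ℤ.- + 2) g
    decomposes   : F ≃ f +ᶠ ι t *ᶠ g

------------------------------------------------------------------------
-- The polynomials Aₙ and the rational functions aₙ

A : ℕ → Laurent
A n = sum (map (λ π → s^ (+ des π) * t^ (+ exc π)) (𝔖 n))

a : ℕ → Rational
a zero      = ι 0#
a n@(suc _) = (A n - t^ (+ n) * A n [1/t]) / 1# - t [ regular-1-t ]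

{-# OPTIONS --safe #-}

-- Let w = s^cdes t^wexc, where cdes counts cyclic descents and wexc weak
-- excedances. Reverse-complementation gives tⁿ Aₙ(s,1/t) = Σ s^des(σ) t^wexc(σ),
-- which is called Ãₙ here; rotating the positions of every permutation gives
-- t Aₙ = Σ s^des(σ₂…σₙσ₁) t^wexc(σ). Both exponents of s differ from cdes(σ) by
-- one bit, so that
--
--   s (Ãₙ - t Aₙ) = (s - 1) (Σ_{σ₁ > σ₂} w - Σ_{σₙ > σ₁} w).
--
-- Conjugation by the n-cycle preserves w and turns the condition σₙ > σ₁ into
-- σ₁ > σ₂, except when σ₁ or σ₂ is the least value. Since σ₂ = 1 corresponds to
-- σ₁ = n, the right-hand difference is Σ_{σ₁ = n} w - Σ_{σ₁ = 1} w, which is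
-- s t (Aₙ₋₁ - Ãₙ₋₁) by deletion of σ₁. After cancelling s, this is the
-- decomposition multiplied by 1 - t.

module Submission where

open import Defs
open import Algebra.Bundles using (CommutativeRing)
open import Algebra.Solver.Ring.AlmostCommutativeRing
  using (fromCommutativeRing; _-Raw-AlmostCommutative⟶_)
open import Data.Bool.Base using (if_then_else_)
open import Data.Fin.Base as Fin
  using (Fin; zero; suc; inject₁; fromℕ; toℕ; opposite; punchIn; punchOut)
open import Data.Fin.Permutation as Perm
  using (Permutation′; permutation; flip; _⟨$⟩ʳ_; _⟨$⟩ˡ_)
import Data.Fin.Properties as Fin
open import Data.Fin.Relation.Unary.Top using (view; ‵fromℕ; ‵inject₁; view-fromℕ; view-inject₁)
open import Data.Integer.Base using (+_) renaming (_-_ to _-ℤ_)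
open import Data.Integer.Base as ℤ using (ℤ; 0ℤ; 1ℤ)
import Data.Integer.Properties as ℤ
open import Data.List.Base as List using (List; []; _∷_; [_])
open import Data.List.Membership.Propositional using (_∈_)
open import Data.List.Membership.Propositional.Properties
  using (∈-cartesianProductWith⁺; ∈-allFin; ∈-filter⁺; ∈-filter⁻; ∈-map⁺; ∈-map⁻)
open import Data.List.Membership.Propositional.Properties.WithK using (unique∧set⇒bag)
open import Data.List.Properties using (++-assoc; ++-identityʳ; map-++; map-∘)
open import Data.List.Relation.Binary.BagAndSetEquality using (∼bag⇒↭)
open import Data.List.Relation.Binary.Permutation.Propositional as ↭ using (_↭_)
open import Data.List.Relation.Unary.All as All using (All; []; _∷_)
import Data.List.Relation.Unary.All.Properties as All
open import Data.List.Relation.Unary.AllPairs using ([]; _∷_)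
open import Data.List.Relation.Unary.Any using (here; there)
import Data.List.Relation.Unary.Unique.Propositional as List
import Data.List.Relation.Unary.Unique.Propositional.Properties as List
open import Data.Maybe.Base using (Maybe; just; nothing)
open import Data.Nat.Base using (ℕ; _≤_; _∸_)
open import Data.Nat.Base as ℕ using (zero; suc; z≤n; s≤s)
import Data.Nat.Properties as ℕ
open import Algebra.Properties.CommutativeMonoid.Sum ℕ.+-0-commutativeMonoid
  using (sum-permute; sum-cong-≗; ∑-distrib-+; sum-init-last) renaming (sum to ∑)
open import Data.Product using (∃; _×_; _,_; proj₁; proj₂)
open import Data.Vec.Base as Vec using (Vec; []; _∷_; lookup; tabulate; count)
open import Data.Vec.Properties
  using (lookup-map; lookup∘tabulate; tabulate∘lookup; tabulate-cong; ∷-injective)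
import Data.Vec.Relation.Unary.Unique.Propositional as Vec
import Data.Vec.Relation.Unary.Unique.Propositional.Properties as Vec
open import Function.Base using (_∘_; id)
open import Function.Bundles using (mk⇔)
open import Function.Definitions using (Injective)
open import Level using (0ℓ)
open import Relation.Binary.Bundles using (Setoid)
open import Relation.Binary.PropositionalEquality hiding ([_])
open import Relation.Binary.Structures using (IsEquivalence)
open import Relation.Nullary using (Dec; yes; no; does; ¬_; contradiction; _×-dec_)
open import Relation.Nullary.Decidable using (does-⇔; dec-true; dec-false)
open import Relation.Unary using (Pred; Decidable)

private
  variable
    k m n : ℕ
    B C P Q : Set

-- Descents and excedances of functions

-- The Iverson bracket. Going through `does` lets two brackets be identified from a bare equivalence
-- (`⟦⟧-cong`), whatever the two decision procedures are.
⟦_⟧ : Dec P → ℕ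
⟦ p? ⟧ = if does p? then 1 else 0

⟦⟧-cong : (p? : Dec P) (q? : Dec Q) → (P → Q) → (Q → P) → ⟦ p? ⟧ ≡ ⟦ q? ⟧
⟦⟧-cong p? q? to from = cong (if_then 1 else 0) (does-⇔ (mk⇔ to from) p? q?)

⟦⟧-true : (p? : Dec P) → P → ⟦ p? ⟧ ≡ 1
⟦⟧-true p? p = cong (if_then 1 else 0) (dec-true p? p)

⟦⟧-false : (p? : Dec P) → ¬ P → ⟦ p? ⟧ ≡ 0
⟦⟧-false p? ¬p = cong (if_then 1 else 0) (dec-false p? ¬p)

-- With `f = id` this turns `des` and `exc`, which count over `allFin`, into sums over `Fin`, which
-- can be reindexed by a permutation.
count-tabulate : ∀ {A : Set} {P : Pred A _} (P? : Decidable P) (f : Fin n → A) →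
  count P? (tabulate f) ≡ ∑ (λ i → ⟦ P? (f i) ⟧)
count-tabulate {zero}  P? f = refl
count-tabulate {suc n} P? f with P? (f zero)
... | yes _ = cong suc (count-tabulate P? (f ∘ suc))
... | no  _ = count-tabulate P? (f ∘ suc)

desF : (Fin (suc m) → Fin n) → ℕ
desF σ = ∑ (λ i → ⟦ σ (suc i) Fin.<? σ (inject₁ i) ⟧)

excF wexcF nonexcF : (Fin n → Fin n) → ℕ
excF    σ = ∑ (λ i → ⟦ i Fin.<? σ i ⟧)
wexcF   σ = ∑ (λ i → ⟦ i Fin.≤? σ i ⟧)
nonexcF σ = ∑ (λ i → ⟦ σ i Fin.≤? i ⟧)

des≡desF : (π : Vec (Fin (suc m)) (suc m)) → des π ≡ desF (lookup π)
des≡desF π = count-tabulate (λ i → lookup π (suc i) Fin.<? lookup π (inject₁ i)) id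

exc≡excF : (π : Vec (Fin n) n) → exc π ≡ excF (lookup π)
exc≡excF π = count-tabulate (λ i → i Fin.<? lookup π i) id

∑-const-1 : ∀ n → ∑ {n} (λ _ → 1) ≡ n
∑-const-1 zero    = refl
∑-const-1 (suc n) = cong suc (∑-const-1 n)

excF+nonexcF : (σ : Fin n → Fin n) → excF σ ℕ.+ nonexcF σ ≡ n
excF+nonexcF σ = trans (sym (∑-distrib-+ (λ i → ⟦ i Fin.<? σ i ⟧) (λ i → ⟦ σ i Fin.≤? i ⟧)))
  (trans (sum-cong-≗ lem) (∑-const-1 _))
  where
  lem : ∀ i → ⟦ i Fin.<? σ i ⟧ ℕ.+ ⟦ σ i Fin.≤? i ⟧ ≡ 1
  lem i with i Fin.<? σ i
  ... | yes i<σi = cong₂ ℕ._+_ (⟦⟧-true (i Fin.<? σ i) i<σi) (⟦⟧-false (σ i Fin.≤? i) (ℕ.<⇒≱ i<σi))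
  ... | no  i≮σi = cong₂ ℕ._+_ (⟦⟧-false (i Fin.<? σ i) i≮σi) (⟦⟧-true (σ i Fin.≤? i) (ℕ.≮⇒≥ i≮σi))

-- Reverse-complementation.

opposite-inject₁ : (i : Fin n) → opposite (inject₁ i) ≡ suc (opposite i)
opposite-inject₁ zero    = refl
opposite-inject₁ (suc i) = cong inject₁ (opposite-inject₁ i)

opposite-mono-≤ : {i j : Fin n} → i Fin.≤ j → opposite j Fin.≤ opposite i
opposite-mono-≤ {n} {i} {j} i≤j
  rewrite Fin.opposite-prop i | Fin.opposite-prop j = ℕ.∸-monoʳ-≤ n (s≤s i≤j)

opposite-cancel-≤ : {i j : Fin n} → opposite j Fin.≤ opposite i → i Fin.≤ j
opposite-cancel-≤ {i = i} {j} le =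
  subst₂ Fin._≤_ (Fin.opposite-involutive i) (Fin.opposite-involutive j) (opposite-mono-≤ le)

opposite-⟦<⟧ : (i j : Fin n) → ⟦ opposite i Fin.<? opposite j ⟧ ≡ ⟦ j Fin.<? i ⟧
opposite-⟦<⟧ i j = ⟦⟧-cong (opposite i Fin.<? opposite j) (j Fin.<? i)
  (λ lt → ℕ.≰⇒> (λ i≤j → ℕ.<⇒≱ lt (opposite-mono-≤ {i = i} {j} i≤j)))
  (λ lt → ℕ.≰⇒> (λ le → ℕ.<⇒≱ lt (opposite-cancel-≤ {i = i} {j} le)))

opposite-⟦≤⟧ : (i j : Fin n) → ⟦ opposite i Fin.≤? opposite j ⟧ ≡ ⟦ j Fin.≤? i ⟧
opposite-⟦≤⟧ i j = ⟦⟧-cong (opposite i Fin.≤? opposite j) (j Fin.≤? i)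
  (opposite-cancel-≤ {i = j} {i}) (opposite-mono-≤ {i = j} {i})

-- Reversing positions swaps the two entries of an adjacent pair, and complementing values reverses
-- their order again, so descents go to descents.
desF-reverse-complement : (σ : Fin (suc m) → Fin (suc m)) →
  desF (opposite ∘ σ ∘ opposite) ≡ desF σ
desF-reverse-complement σ = begin
  desF (opposite ∘ σ ∘ opposite)
    -- `opposite (suc i)` is `inject₁ (opposite i)` by definition, so only the position
    -- `opposite (inject₁ i)` has to be rewritten.
    ≡⟨ sum-cong-≗ (λ i → trans (opposite-⟦<⟧ (σ (inject₁ (opposite i))) (σ (opposite (inject₁ i))))
         (cong (λ j → ⟦ σ j Fin.<? σ (inject₁ (opposite i)) ⟧) (opposite-inject₁ i))) ⟩
  ∑ (λ i → ⟦ σ (suc (opposite i)) Fin.<? σ (inject₁ (opposite i)) ⟧)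
    ≡⟨ sum-permute (λ i → ⟦ σ (suc i) Fin.<? σ (inject₁ i) ⟧) Perm.reverse ⟨
  desF σ ∎
  where open ≡-Reasoning

-- Put `j = opposite i`: the condition `opposite j ≤ opposite (σ j)` is `σ j ≤ j`.
wexcF-reverse-complement : (σ : Fin n → Fin n) →
  wexcF (opposite ∘ σ ∘ opposite) ≡ nonexcF σ
wexcF-reverse-complement σ = begin
  wexcF (opposite ∘ σ ∘ opposite)
    ≡⟨ sum-permute (λ i → ⟦ i Fin.≤? opposite (σ (opposite i)) ⟧) Perm.reverse ⟩
  ∑ (λ i → ⟦ opposite i Fin.≤? opposite (σ (opposite (opposite i))) ⟧)
    ≡⟨ sum-cong-≗ (λ i → trans
         (cong (λ j → ⟦ opposite i Fin.≤? opposite (σ j) ⟧) (Fin.opposite-involutive i))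
         (opposite-⟦≤⟧ i (σ i))) ⟩
  nonexcF σ ∎
  where open ≡-Reasoning

-- The n-cycle, rotation of positions and conjugation.

prev next : Fin (suc m) → Fin (suc m)
prev {m} zero = fromℕ m
prev (suc i)  = inject₁ i

next i with view i
... | ‵fromℕ     = zero
... | ‵inject₁ j = suc j

next-fromℕ : ∀ m → next (fromℕ m) ≡ zero
next-fromℕ m rewrite view-fromℕ m = refl

next-inject₁ : (i : Fin m) → next (inject₁ i) ≡ suc i
next-inject₁ i rewrite view-inject₁ i = refl

next-prev : (i : Fin (suc m)) → next (prev i) ≡ i
next-prev zero    = next-fromℕ _
next-prev (suc i) = next-inject₁ i

prev-next : (i : Fin (suc m)) → prev (next i) ≡ i
prev-next i with view i
... | ‵fromℕ     = refl
... | ‵inject₁ j = refl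

prev≡fromℕ : (i : Fin (suc m)) → prev i ≡ fromℕ m → i ≡ zero
prev≡fromℕ zero    _  = refl
prev≡fromℕ (suc i) eq = contradiction (sym eq) Fin.fromℕ≢inject₁

cycle : Permutation′ (suc m)
cycle = permutation next prev next-prev prev-next

-- The index `zero` carries the wrap-around pair of last and first entry. Hence `cdesF σ` unfolds to
-- that bit plus `desF σ`, which later proofs use without rewriting.
cdesF : (Fin (suc m) → Fin n) → ℕ
cdesF σ = ∑ (λ i → ⟦ σ i Fin.<? σ (prev i) ⟧)

toℕ-inject₁<fromℕ : (i : Fin m) → inject₁ i Fin.< fromℕ m
toℕ-inject₁<fromℕ {m} i rewrite Fin.toℕ-inject₁ i | Fin.toℕ-fromℕ m = Fin.toℕ<n i

-- prev moves zero to the top and otherwise preserves the order.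
prev-⟦<⟧ : (a b : Fin (suc m)) →
  ⟦ prev a Fin.<? prev b ⟧ ℕ.+ ⟦ a Fin.≟ zero ⟧ ≡ ⟦ a Fin.<? b ⟧ ℕ.+ ⟦ b Fin.≟ zero ⟧
prev-⟦<⟧ {m} zero zero = cong (ℕ._+ 1) (⟦⟧-false (fromℕ m Fin.<? fromℕ m) (ℕ.<-irrefl refl))
prev-⟦<⟧ {m} zero (suc b) = cong (ℕ._+ 1) (⟦⟧-false (fromℕ m Fin.<? inject₁ b)
  (ℕ.<-asym (toℕ-inject₁<fromℕ b)))
prev-⟦<⟧ {m} (suc a) zero = cong (ℕ._+ 0) (⟦⟧-true (inject₁ a Fin.<? fromℕ m) (toℕ-inject₁<fromℕ a))
prev-⟦<⟧ (suc a) (suc b) = cong (ℕ._+ 0) (⟦⟧-cong (inject₁ a Fin.<? inject₁ b) (suc a Fin.<? suc b)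
  (λ lt → s≤s (subst₂ ℕ._<_ (Fin.toℕ-inject₁ a) (Fin.toℕ-inject₁ b) lt))
  (λ { (s≤s lt) → subst₂ ℕ._<_ (sym (Fin.toℕ-inject₁ a)) (sym (Fin.toℕ-inject₁ b)) lt }))

prev-⟦≤⟧ : (a b : Fin (suc m)) →
  ⟦ prev a Fin.≤? prev b ⟧ ℕ.+ ⟦ a Fin.≟ zero ⟧ ≡ ⟦ a Fin.≤? b ⟧ ℕ.+ ⟦ b Fin.≟ zero ⟧
prev-⟦≤⟧ {m} zero zero = cong (ℕ._+ 1) (⟦⟧-true (fromℕ m Fin.≤? fromℕ m) ℕ.≤-refl)
prev-⟦≤⟧ {m} zero (suc b) = cong (ℕ._+ 1) (⟦⟧-false (fromℕ m Fin.≤? inject₁ b)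
  (ℕ.<⇒≱ (toℕ-inject₁<fromℕ b)))
prev-⟦≤⟧ {m} (suc a) zero = cong (ℕ._+ 0) (⟦⟧-true (inject₁ a Fin.≤? fromℕ m) (ℕ.<⇒≤ (toℕ-inject₁<fromℕ a)))
prev-⟦≤⟧ (suc a) (suc b) = cong (ℕ._+ 0) (⟦⟧-cong (inject₁ a Fin.≤? inject₁ b) (suc a Fin.≤? suc b)
  (λ le → s≤s (subst₂ ℕ._≤_ (Fin.toℕ-inject₁ a) (Fin.toℕ-inject₁ b) le))
  (λ { (s≤s le) → subst₂ ℕ._≤_ (sym (Fin.toℕ-inject₁ a)) (sym (Fin.toℕ-inject₁ b)) le }))

conj : (Fin (suc m) → Fin (suc m)) → Fin (suc m) → Fin (suc m)
conj σ = prev ∘ σ ∘ next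

∑-prev : (f : Fin (suc m) → ℕ) → ∑ (f ∘ prev) ≡ ∑ f
∑-prev f = sym (sum-permute f (flip cycle))

-- Shifting positions only permutes the summands. Shifting values changes the comparisons next to a
-- value `zero`; by `prev-⟦<⟧` the corrections are `z i` on one side and `z (prev i)` on the other,
-- and these have equal sums.
cdesF-conj : (σ : Fin (suc m) → Fin (suc m)) → cdesF (conj σ) ≡ cdesF σ
cdesF-conj σ = ℕ.+-cancelʳ-≡ (∑ z) _ _ (begin
  cdesF (conj σ) ℕ.+ ∑ z
    ≡⟨ cong (ℕ._+ ∑ z) (∑-prev (λ i → ⟦ conj σ i Fin.<? conj σ (prev i) ⟧)) ⟨
  ∑ (λ i → ⟦ conj σ (prev i) Fin.<? conj σ (prev (prev i)) ⟧) ℕ.+ ∑ z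
    ≡⟨ cong (ℕ._+ ∑ z) (sum-cong-≗ (λ i →
         cong₂ (λ j k → ⟦ prev (σ j) Fin.<? prev (σ k) ⟧) (next-prev i) (next-prev (prev i)))) ⟩
  ∑ (λ i → ⟦ prev (σ i) Fin.<? prev (σ (prev i)) ⟧) ℕ.+ ∑ z
    ≡⟨ ∑-distrib-+ (λ i → ⟦ prev (σ i) Fin.<? prev (σ (prev i)) ⟧) z ⟨
  ∑ (λ i → ⟦ prev (σ i) Fin.<? prev (σ (prev i)) ⟧ ℕ.+ z i)
    ≡⟨ sum-cong-≗ (λ i → prev-⟦<⟧ (σ i) (σ (prev i))) ⟩
  ∑ (λ i → ⟦ σ i Fin.<? σ (prev i) ⟧ ℕ.+ z (prev i))
    ≡⟨ ∑-distrib-+ (λ i → ⟦ σ i Fin.<? σ (prev i) ⟧) (z ∘ prev) ⟩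
  cdesF σ ℕ.+ ∑ (z ∘ prev)
    ≡⟨ cong (cdesF σ ℕ.+_) (∑-prev z) ⟩
  cdesF σ ℕ.+ ∑ z ∎)
  where
  open ≡-Reasoning
  z : Fin _ → ℕ
  z i = ⟦ σ i Fin.≟ zero ⟧

-- Pigeonhole: if `i` were missed, punching it out would inject `Fin (suc n)` into `Fin n`.
injective⇒preimage : {σ : Fin n → Fin n} → Injective _≡_ _≡_ σ → ∀ i → ∃ λ j → σ j ≡ i
injective⇒preimage {suc n} {σ} inj i with Fin.any? (λ j → σ j Fin.≟ i)
... | yes found = found
... | no  avoid = contradiction
  (Fin.injective⇒≤ {f = λ j → punchOut (i≢σ j)} (λ {j} {k} eq → inj (Fin.punchOut-injective (i≢σ j) (i≢σ k) eq)))
  ℕ.1+n≰n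
  where
  i≢σ : ∀ j → i ≢ σ j
  i≢σ j i≡σj = avoid (j , sym i≡σj)

injective⇒permutation : {σ : Fin n → Fin n} → Injective _≡_ _≡_ σ → Permutation′ n
injective⇒permutation {σ = σ} inj =
  permutation σ (proj₁ ∘ pre) (proj₂ ∘ pre) (λ i → inj (proj₂ (pre (σ i))))
  where pre = injective⇒preimage inj

-- Here the corrections from `prev-⟦≤⟧` are `z i` and `z (σ i)`. Their sums agree because σ is a
-- bijection, which is where injectivity enters.
wexcF-conj : {σ : Fin (suc m) → Fin (suc m)} → Injective _≡_ _≡_ σ → wexcF (conj σ) ≡ wexcF σ
wexcF-conj {σ = σ} inj = ℕ.+-cancelʳ-≡ (∑ z) _ _ (begin
  wexcF (conj σ) ℕ.+ ∑ z
    ≡⟨ cong (ℕ._+ ∑ z) (∑-prev (λ i → ⟦ i Fin.≤? conj σ i ⟧)) ⟨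
  ∑ (λ i → ⟦ prev i Fin.≤? conj σ (prev i) ⟧) ℕ.+ ∑ z
    ≡⟨ cong (ℕ._+ ∑ z) (sum-cong-≗ (λ i → cong (λ j → ⟦ prev i Fin.≤? prev (σ j) ⟧) (next-prev i))) ⟩
  ∑ (λ i → ⟦ prev i Fin.≤? prev (σ i) ⟧) ℕ.+ ∑ z
    ≡⟨ ∑-distrib-+ (λ i → ⟦ prev i Fin.≤? prev (σ i) ⟧) z ⟨
  ∑ (λ i → ⟦ prev i Fin.≤? prev (σ i) ⟧ ℕ.+ z i)
    ≡⟨ sum-cong-≗ (λ i → prev-⟦≤⟧ i (σ i)) ⟩
  ∑ (λ i → ⟦ i Fin.≤? σ i ⟧ ℕ.+ z (σ i))
    ≡⟨ ∑-distrib-+ (λ i → ⟦ i Fin.≤? σ i ⟧) (z ∘ σ) ⟩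
  wexcF σ ℕ.+ ∑ (z ∘ σ)
    ≡⟨ cong (wexcF σ ℕ.+_) (sum-permute z (injective⇒permutation inj)) ⟨
  wexcF σ ℕ.+ ∑ z ∎)
  where
  open ≡-Reasoning
  z : Fin _ → ℕ
  z i = ⟦ i Fin.≟ zero ⟧

cdesF-rotate : (σ : Fin (suc m) → Fin n) → cdesF (σ ∘ prev) ≡ cdesF σ
cdesF-rotate σ = ∑-prev (λ i → ⟦ σ i Fin.<? σ (prev i) ⟧)

-- The entry σᵢ moves to position i + 1, and i + 1 ≤ σᵢ means i < σᵢ. Position `zero` is always a
-- weak excedance, which gives the `suc`.
wexcF-rotate : (σ : Fin (suc m) → Fin (suc m)) → wexcF (σ ∘ prev) ≡ suc (excF σ)
wexcF-rotate {m} σ = cong suc (begin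
  ∑ (λ i → ⟦ suc i Fin.≤? σ (inject₁ i) ⟧)
    ≡⟨ sum-cong-≗ (λ i → ⟦⟧-cong (suc i Fin.≤? σ (inject₁ i)) (inject₁ i Fin.<? σ (inject₁ i))
         (subst (ℕ._< toℕ (σ (inject₁ i))) (sym (Fin.toℕ-inject₁ i)))
         (subst (ℕ._< toℕ (σ (inject₁ i))) (Fin.toℕ-inject₁ i))) ⟩
  ∑ (λ i → ⟦ inject₁ i Fin.<? σ (inject₁ i) ⟧)
    ≡⟨ ℕ.+-identityʳ _ ⟨
  ∑ (λ i → ⟦ inject₁ i Fin.<? σ (inject₁ i) ⟧) ℕ.+ 0
    -- The last position is never an excedance of σ, so its term can be added to complete the sum.
    ≡⟨ cong (∑ (λ i → ⟦ inject₁ i Fin.<? σ (inject₁ i) ⟧) ℕ.+_) (⟦⟧-false (fromℕ m Fin.<? σ (fromℕ m))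
         (ℕ.≤⇒≯ (Fin.≤fromℕ _))) ⟨
  ∑ (λ i → ⟦ inject₁ i Fin.<? σ (inject₁ i) ⟧) ℕ.+ ⟦ fromℕ m Fin.<? σ (fromℕ m) ⟧
    ≡⟨ sum-init-last (λ i → ⟦ i Fin.<? σ i ⟧) ⟨
  excF σ ∎)
  where open ≡-Reasoning

-- The word σ₂...σₙσ₁ has the same cyclic descents as σ, and its wrap-around pair is (σ₁, σ₂).
desF-next : (σ : Fin (suc (suc m)) → Fin n) →
  ⟦ σ (suc zero) Fin.<? σ zero ⟧ ℕ.+ desF (σ ∘ next) ≡ cdesF σ
desF-next {m} σ = begin
  ⟦ σ (suc zero) Fin.<? σ zero ⟧ ℕ.+ desF (σ ∘ next)
    ≡⟨ cong (λ i → ⟦ σ (suc zero) Fin.<? σ i ⟧ ℕ.+ desF (σ ∘ next)) (next-fromℕ (suc m)) ⟨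
  cdesF (σ ∘ next)
    ≡⟨ cdesF-rotate (σ ∘ next) ⟨
  cdesF (σ ∘ next ∘ prev)
    ≡⟨ sum-cong-≗ (λ i → cong₂ (λ j k → ⟦ σ j Fin.<? σ k ⟧) (next-prev i) (next-prev (prev i))) ⟩
  cdesF σ ∎
  where open ≡-Reasoning

-- Insertion of a first value.

toℕ-punchIn-fromℕ : (i : Fin m) → toℕ (punchIn (fromℕ m) i) ≡ toℕ i
toℕ-punchIn-fromℕ zero    = refl
toℕ-punchIn-fromℕ (suc i) = cong suc (toℕ-punchIn-fromℕ i)

punchIn-⟦<⟧ : (x : Fin (suc m)) (i j : Fin m) →
  ⟦ punchIn x i Fin.<? punchIn x j ⟧ ≡ ⟦ i Fin.<? j ⟧
punchIn-⟦<⟧ x i j = ⟦⟧-cong (punchIn x i Fin.<? punchIn x j) (i Fin.<? j)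
  (λ lt → ℕ.≰⇒> (λ j≤i → ℕ.<⇒≱ lt (Fin.punchIn-mono-≤ x j i j≤i)))
  (λ lt → ℕ.≰⇒> (λ le → ℕ.<⇒≱ lt (Fin.punchIn-cancel-≤ x j i le)))

-- The inverse of deleting the first entry `x` and standardizing the rest; `punchIn x` keeps the
-- relative order and avoids `x`.
prepend : Fin (suc m) → Vec (Fin m) m → Vec (Fin (suc m)) (suc m)
prepend x τ = x ∷ Vec.map (punchIn x) τ

module _ {m} (x : Fin (suc (suc m))) (τ : Vec (Fin (suc m)) (suc m)) where
  private
    τ′ = lookup τ
    σ  = lookup (prepend x τ)

    σ-suc : ∀ i → σ (suc i) ≡ punchIn x (τ′ i)
    σ-suc i = lookup-map i (punchIn x) τ

  desF-tail : ∑ (λ i → ⟦ σ (suc (suc i)) Fin.<? σ (suc (inject₁ i)) ⟧) ≡ desF τ′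
  desF-tail = sum-cong-≗ (λ i → trans
    (cong₂ (λ a b → ⟦ a Fin.<? b ⟧) (σ-suc (suc i)) (σ-suc (inject₁ i)))
    (punchIn-⟦<⟧ x (τ′ (suc i)) (τ′ (inject₁ i))))

  wexcF-prepend : wexcF σ ≡ suc (∑ (λ i → ⟦ suc i Fin.≤? punchIn x (τ′ i) ⟧))
  wexcF-prepend = cong suc (sum-cong-≗ (λ i → cong (λ a → ⟦ suc i Fin.≤? a ⟧) (σ-suc i)))

module _ {m} (τ : Vec (Fin (suc m)) (suc m)) where
  private
    τ′ = lookup τ

  -- A leading least value is entered by a cyclic descent from the last entry and left by an ascent.
  cdesF-prepend-zero : cdesF (lookup (prepend zero τ)) ≡ suc (desF τ′)
  cdesF-prepend-zero = cong₂ ℕ._+_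
    (⟦⟧-true (zero {suc m} Fin.<? lookup (Vec.map suc τ) (fromℕ m))
      (subst (λ a → 0 ℕ.< toℕ a) (sym (lookup-map (fromℕ m) suc τ)) (s≤s z≤n)))
    (desF-tail zero τ)

  -- A leading greatest value is entered by an ascent and left by a descent.
  cdesF-prepend-fromℕ : cdesF (lookup (prepend (fromℕ (suc m)) τ)) ≡ suc (desF τ′)
  cdesF-prepend-fromℕ = cong₂ ℕ._+_
    (⟦⟧-false (fromℕ (suc m) Fin.<? σ (fromℕ (suc m))) (ℕ.≤⇒≯ (Fin.≤fromℕ _)))
    (cong₂ ℕ._+_ (⟦⟧-true (σ (suc zero) Fin.<? fromℕ (suc m))
      (subst₂ ℕ._<_ (trans (sym (toℕ-punchIn-fromℕ (τ′ zero)))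
          (cong toℕ (sym (lookup-map zero (punchIn (fromℕ (suc m))) τ))))
        (sym (Fin.toℕ-fromℕ (suc m))) (Fin.toℕ<n (τ′ zero))))
      (desF-tail (fromℕ (suc m)) τ))
    where σ = lookup (prepend (fromℕ (suc m)) τ)

  wexcF-prepend-zero : wexcF (lookup (prepend zero τ)) ≡ suc (wexcF τ′)
  wexcF-prepend-zero = trans (wexcF-prepend zero τ)
    (cong suc (sum-cong-≗ (λ i → ⟦⟧-cong (suc i Fin.≤? suc (τ′ i)) (i Fin.≤? τ′ i) ℕ.≤-pred s≤s)))

  -- Positions move up by one while the values of τ stay, so weak excedances after the first
  -- position are strict excedances of τ. With a leading `zero` the values move too, and weak
  -- excedances stay weak.
  wexcF-prepend-fromℕ : wexcF (lookup (prepend (fromℕ (suc m)) τ)) ≡ suc (excF τ′)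
  wexcF-prepend-fromℕ = trans (wexcF-prepend (fromℕ (suc m)) τ)
    (cong suc (sum-cong-≗ (λ i → ⟦⟧-cong (suc i Fin.≤? punchIn (fromℕ (suc m)) (τ′ i)) (i Fin.<? τ′ i)
      (subst (toℕ i ℕ.<_) (toℕ-punchIn-fromℕ (τ′ i)))
      (subst (toℕ i ℕ.<_) (sym (toℕ-punchIn-fromℕ (τ′ i)))))))

-- Reindexing sums over 𝔖 n

∈-words : (w : Vec (Fin k) n) → w ∈ words k n
∈-words []      = here refl
∈-words (x ∷ w) = ∈-cartesianProductWith⁺ _∷_ (∈-allFin x) (∈-words w)

words-unique : ∀ k n → List.Unique (words k n)
words-unique k zero    = [] ∷ []
words-unique k (suc n) = List.cartesianProductWith⁺ _∷_ ∷-injective (List.allFin⁺ k) (words-unique k n)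

𝔖-unique : ∀ n → List.Unique (𝔖 n)
𝔖-unique n = List.filter⁺ unique? (words-unique n n)

∈-𝔖⁺ : {w : Vec (Fin n) n} → Injective _≡_ _≡_ (lookup w) → w ∈ 𝔖 n
∈-𝔖⁺ {w = w} inj = ∈-filter⁺ unique? (∈-words w)
  (subst Vec.Unique (tabulate∘lookup w) (Vec.tabulate⁺ inj))

∈-𝔖⁻ : {w : Vec (Fin n) n} → w ∈ 𝔖 n → Injective _≡_ _≡_ (lookup w)
∈-𝔖⁻ {n} w∈𝔖 = Vec.lookup-injective (proj₂ (∈-filter⁻ unique? {xs = words n n} w∈𝔖)) _ _

-- Duplicate-free lists with the same elements are rearrangements of each other; this makes every
-- bijection between sets of words a reindexing of sums.
map-bijection-↭ : ∀ {A B : Set} {f : A → B} {xs ys} → List.Unique xs → List.Unique ys →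
  Injective _≡_ _≡_ f → (∀ {x} → x ∈ xs → f x ∈ ys) → (∀ {y} → y ∈ ys → ∃ λ x → x ∈ xs × y ≡ f x) →
  List.map f xs ↭ ys
map-bijection-↭ {f = f} {xs} {ys} xs! ys! inj to from =
  ∼bag⇒↭ (unique∧set⇒bag (List.map⁺ inj xs!) ys! (mk⇔
    (λ y∈ → let (x , x∈xs , y≡fx) = ∈-map⁻ f y∈ in subst (_∈ ys) (sym y≡fx) (to x∈xs))
    (λ y∈ys → let (x , x∈xs , y≡fx) = from y∈ys in subst (_∈ List.map f xs) (sym y≡fx) (∈-map⁺ f x∈xs))))

-- The word of g ∘ w ∘ h. Reverse-complementation, rotation and conjugation by the cycle are all of
-- this form.
relabel : Permutation′ n → Permutation′ n → Vec (Fin n) n → Vec (Fin n) n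
relabel g h w = tabulate (λ i → g ⟨$⟩ʳ (lookup w (h ⟨$⟩ʳ i)))

lookup-relabel : ∀ (g h : Permutation′ n) w i → lookup (relabel g h w) i ≡ g ⟨$⟩ʳ (lookup w (h ⟨$⟩ʳ i))
lookup-relabel g h w = lookup∘tabulate (λ i → g ⟨$⟩ʳ (lookup w (h ⟨$⟩ʳ i)))

relabel-flip : ∀ (g h : Permutation′ n) w → relabel (flip g) (flip h) (relabel g h w) ≡ w
relabel-flip g h w = trans (tabulate-cong lem) (tabulate∘lookup w)
  where
  open ≡-Reasoning
  lem : ∀ i → g ⟨$⟩ˡ (lookup (relabel g h w) (h ⟨$⟩ˡ i)) ≡ lookup w i
  lem i = begin
    g ⟨$⟩ˡ (lookup (relabel g h w) (h ⟨$⟩ˡ i))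
      ≡⟨ cong (g ⟨$⟩ˡ_) (lookup-relabel g h w (h ⟨$⟩ˡ i)) ⟩
    g ⟨$⟩ˡ (g ⟨$⟩ʳ (lookup w (h ⟨$⟩ʳ (h ⟨$⟩ˡ i))))
      ≡⟨ Perm.inverseˡ g ⟩
    lookup w (h ⟨$⟩ʳ (h ⟨$⟩ˡ i))
      ≡⟨ cong (lookup w) (Perm.inverseʳ h) ⟩
    lookup w i ∎

relabel-∈-𝔖 : ∀ (g h : Permutation′ n) {w} → w ∈ 𝔖 n → relabel g h w ∈ 𝔖 n
relabel-∈-𝔖 g h {w} w∈𝔖 = ∈-𝔖⁺ λ {i} {j} eq →
  injective h (∈-𝔖⁻ w∈𝔖 (injective g
    (trans (sym (lookup-relabel g h w i)) (trans eq (lookup-relabel g h w j)))))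
  where
  injective : (π : Permutation′ _) → Injective _≡_ _≡_ (π ⟨$⟩ʳ_)
  injective π eq = trans (sym (Perm.inverseˡ π)) (trans (cong (π ⟨$⟩ˡ_) eq) (Perm.inverseˡ π))

𝔖-relabel-↭ : (g h : Permutation′ n) → List.map (relabel g h) (𝔖 n) ↭ 𝔖 n
𝔖-relabel-↭ {n} g h = map-bijection-↭ (𝔖-unique n) (𝔖-unique n)
  (λ {v} {w} eq → trans (sym (relabel-flip g h v))
    (trans (cong (relabel (flip g) (flip h)) eq) (relabel-flip g h w)))
  (relabel-∈-𝔖 g h)
  (λ {w} w∈𝔖 → relabel (flip g) (flip h) w , relabel-∈-𝔖 (flip g) (flip h) w∈𝔖
    , sym (relabel-flip (flip g) (flip h) w))

first≟ : (x : Fin (suc m)) (w : Vec (Fin (suc m)) (suc m)) → Dec (lookup w zero ≡ x)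
first≟ x w = lookup w zero Fin.≟ x

prepend-injective : (x : Fin (suc m)) → Injective _≡_ _≡_ (prepend x)
prepend-injective x {v} {w} eq = begin
  v                    ≡⟨ tabulate∘lookup v ⟨
  tabulate (lookup v)  ≡⟨ tabulate-cong lem ⟩
  tabulate (lookup w)  ≡⟨ tabulate∘lookup w ⟩
  w                    ∎
  where
  open ≡-Reasoning
  lem : ∀ i → lookup v i ≡ lookup w i
  lem i = Fin.punchIn-injective x (lookup v i) (lookup w i)
    (trans (sym (lookup-map i (punchIn x) v))
      (trans (cong (λ u → lookup u (suc i)) eq) (lookup-map i (punchIn x) w)))

prepend-∈-𝔖 : (x : Fin (suc m)) {τ : Vec (Fin m) m} → τ ∈ 𝔖 m → prepend x τ ∈ 𝔖 (suc m)
prepend-∈-𝔖 x {τ} τ∈𝔖 = ∈-𝔖⁺ inj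
  where
  σ-suc : ∀ i → lookup (prepend x τ) (suc i) ≡ punchIn x (lookup τ i)
  σ-suc i = lookup-map i (punchIn x) τ

  inj : Injective _≡_ _≡_ (lookup (prepend x τ))
  inj {zero}  {zero}  eq = refl
  inj {zero}  {suc j} eq = contradiction (trans (sym (σ-suc j)) (sym eq)) (Fin.punchInᵢ≢i x _)
  inj {suc i} {zero}  eq = contradiction (trans (sym (σ-suc i)) eq) (Fin.punchInᵢ≢i x _)
  inj {suc i} {suc j} eq = cong suc (∈-𝔖⁻ τ∈𝔖
    (Fin.punchIn-injective x _ _ (trans (sym (σ-suc i)) (trans eq (σ-suc j)))))

prepend-surjective : {w : Vec (Fin (suc m)) (suc m)} → w ∈ 𝔖 (suc m) →
  ∃ λ τ → τ ∈ 𝔖 m × w ≡ prepend (lookup w zero) τ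
prepend-surjective {m} {x ∷ ρ} w∈𝔖 = tabulate τ , ∈-𝔖⁺ inj , cong (x ∷_) (begin
  ρ                                                       ≡⟨ tabulate∘lookup ρ ⟨
  tabulate (lookup ρ)                                     ≡⟨ tabulate-cong lem ⟩
  tabulate (lookup (Vec.map (punchIn x) (tabulate τ)))    ≡⟨ tabulate∘lookup _ ⟩
  Vec.map (punchIn x) (tabulate τ)                        ∎)
  where
  open ≡-Reasoning
  w-inj : Injective _≡_ _≡_ (lookup (x ∷ ρ))
  w-inj = ∈-𝔖⁻ w∈𝔖

  x≢ρ : ∀ i → x ≢ lookup ρ i
  x≢ρ i eq = Fin.0≢1+n (w-inj {zero} {suc i} eq)

  τ : Fin m → Fin m
  -- The first entry differs from all later ones, so it can be punched out of each of them.
  τ i = punchOut (x≢ρ i)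

  lem : ∀ i → lookup ρ i ≡ lookup (Vec.map (punchIn x) (tabulate τ)) i
  lem i = sym (trans (lookup-map i (punchIn x) (tabulate τ))
    (trans (cong (punchIn x) (lookup∘tabulate τ i)) (Fin.punchIn-punchOut (x≢ρ i))))

  inj : Injective _≡_ _≡_ (lookup (tabulate τ))
  inj {i} {j} eq = Fin.suc-injective (w-inj (Fin.punchOut-injective (x≢ρ i) (x≢ρ j)
    (trans (sym (lookup∘tabulate τ i)) (trans eq (lookup∘tabulate τ j)))))

𝔖-prepend-↭ : (x : Fin (suc m)) → List.map (prepend x) (𝔖 m) ↭ List.filter (first≟ x) (𝔖 (suc m))
𝔖-prepend-↭ {m} x = map-bijection-↭ (𝔖-unique m) (List.filter⁺ (first≟ x) (𝔖-unique (suc m)))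
  (prepend-injective x)
  (λ τ∈𝔖 → ∈-filter⁺ (first≟ x) (prepend-∈-𝔖 x τ∈𝔖) refl)
  (λ w∈ → let (w∈𝔖 , first≡x) = ∈-filter⁻ (first≟ x) w∈
              (τ , τ∈𝔖 , w≡) = prepend-surjective w∈𝔖
          in τ , τ∈𝔖 , subst (λ y → _ ≡ prepend y τ) first≡x w≡)

-- The ring of Laurent polynomials

-- _≈_ as a record, so that both sides can be inferred from a proof
infix 4 _≋_
record _≋_ (p q : Laurent) : Set where
  constructor mk
  field
    coeffwise : p ≈ q

open _≋_

≋-isEquivalence : IsEquivalence _≋_
≋-isEquivalence = record
  { refl  = mk λ _ _ → refl
  ; sym   = λ (mk p≈q) → mk λ i j → sym (p≈q i j)
  ; trans = λ (mk p≈q) (mk q≈r) → mk λ i j → trans (p≈q i j) (q≈r i j)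
  }

open IsEquivalence ≋-isEquivalence
  renaming (refl to ≋-refl; sym to ≋-sym; trans to ≋-trans; reflexive to ≋-reflexive)

≋-setoid : Setoid _ _
≋-setoid = record { isEquivalence = ≋-isEquivalence }

open import Relation.Binary.Reasoning.Setoid ≋-setoid

+-cong : ∀ {p p′ q q′} → p ≋ p′ → q ≋ q′ → p + q ≋ p′ + q′
+-cong {p} {p′} {q} {q′} (mk p≈p′) (mk q≈q′) = mk λ i j →
  trans (coeff-+ p q i j) (trans (cong₂ ℤ._+_ (p≈p′ i j) (q≈q′ i j)) (sym (coeff-+ p′ q′ i j)))

+-comm : ∀ p q → p + q ≋ q + p
+-comm p q = mk λ i j →
  trans (coeff-+ p q i j) (trans (ℤ.+-comm (coeff p i j) _) (sym (coeff-+ q p i j)))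

coeff-neg : ∀ p i j → coeff (- p) i j ≡ ℤ.- coeff p i j
coeff-neg []                i j = refl
coeff-neg ((c , a , b) ∷ p) i j =
  trans (cong₂ ℤ._+_ coeffₜ-neg (coeff-neg p i j))
        (sym (ℤ.neg-distrib-+ (coeffₜ (c , a , b) i j) (coeff p i j)))
  where
  coeffₜ-neg : coeffₜ (ℤ.- c , a , b) i j ≡ ℤ.- coeffₜ (c , a , b) i j
  coeffₜ-neg with a ℤ.≟ i ×-dec b ℤ.≟ j
  ... | yes _ = refl
  ... | no  _ = refl

-‿cong : ∀ {p q} → p ≋ q → - p ≋ - q
-‿cong {p} {q} (mk p≈q) = mk λ i j →
  trans (coeff-neg p i j) (trans (cong ℤ.-_ (p≈q i j)) (sym (coeff-neg q i j)))

+-inverseʳ : ∀ p → p - p ≋ 0#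
+-inverseʳ p = mk λ i j →
  trans (coeff-+ p (- p) i j)
    (trans (cong (ℤ._+_ (coeff p i j)) (coeff-neg p i j)) (ℤ.+-inverseʳ (coeff p i j)))

·-cong : ∀ m {p q} → p ≋ q → m · p ≋ m · q
·-cong (c , a , b) {p} {q} (mk p≈q) = mk λ i j →
  trans (coeff-· c a b p i j)
    (trans (cong (ℤ._*_ c) (p≈q (i ℤ.- a) (j ℤ.- b))) (sym (coeff-· c a b q i j)))

*-congˡ : ∀ p {q q′} → q ≋ q′ → p * q ≋ p * q′
*-congˡ []      q≋q′ = ≋-refl
*-congˡ (m ∷ p) q≋q′ = +-cong (·-cong m q≋q′) (*-congˡ p q≋q′)

*ₜ-comm : ∀ m m′ → m *ₜ m′ ≡ m′ *ₜ m
*ₜ-comm (c , a , b) (c′ , a′ , b′) =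
  cong₂ _,_ (ℤ.*-comm c c′) (cong₂ _,_ (ℤ.+-comm a a′) (ℤ.+-comm b b′))

*-term : ∀ q m → q * [ m ] ≡ m · q
*-term []       m = refl
*-term (m′ ∷ q) m = cong₂ _∷_ (*ₜ-comm m′ m) (*-term q m)

-- `_*_` recurses on its left factor; this splits the right one, which is what the induction for
-- `*-comm` needs.
*-distribˡ-∷ : ∀ q m p → q * (m ∷ p) ≋ q * [ m ] + q * p
*-distribˡ-∷ []       m p = ≋-refl
*-distribˡ-∷ (m′ ∷ q) m p = +-cong {[ m′ *ₜ m ]} ≋-refl (begin
  m′ · p + q * (m ∷ p)          ≈⟨ +-cong ≋-refl (*-distribˡ-∷ q m p) ⟩
  m′ · p + (q * [ m ] + q * p)  ≡⟨ ++-assoc (m′ · p) (q * [ m ]) (q * p) ⟨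
  m′ · p + q * [ m ] + q * p    ≈⟨ +-cong (+-comm (m′ · p) (q * [ m ])) ≋-refl ⟩
  q * [ m ] + m′ · p + q * p    ≡⟨ ++-assoc (q * [ m ]) (m′ · p) (q * p) ⟩
  q * [ m ] + (m′ · p + q * p)  ∎)

*-zeroʳ : ∀ p → p * 0# ≡ 0#
*-zeroʳ []      = refl
*-zeroʳ (_ ∷ p) = *-zeroʳ p

*-comm : ∀ p q → p * q ≋ q * p
*-comm []      q = ≋-reflexive (sym (*-zeroʳ q))
*-comm (m ∷ p) q = begin
  m · q + p * q      ≈⟨ +-cong (≋-reflexive (sym (*-term q m))) (*-comm p q) ⟩
  q * [ m ] + q * p  ≈⟨ *-distribˡ-∷ q m p ⟨
  q * (m ∷ p)        ∎

*-cong : ∀ {p p′ q q′} → p ≋ p′ → q ≋ q′ → p * q ≋ p′ * q′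
*-cong {p} {p′} {q} {q′} p≋p′ q≋q′ = begin
  p * q    ≈⟨ *-congˡ p q≋q′ ⟩
  p * q′   ≈⟨ *-comm p q′ ⟩
  q′ * p   ≈⟨ *-congˡ q′ p≋p′ ⟩
  q′ * p′  ≈⟨ *-comm q′ p′ ⟩
  p′ * q′  ∎

*-identityˡ : ∀ p → 1# * p ≋ p
*-identityˡ p = mk λ i j →
  trans (cong (λ q → coeff q i j) (++-identityʳ ((1ℤ , 0ℤ , 0ℤ) · p)))
    (trans (coeff-· 1ℤ 0ℤ 0ℤ p i j)
      (trans (ℤ.*-identityˡ _) (cong₂ (coeff p) (ℤ.+-identityʳ i) (ℤ.+-identityʳ j))))

*-identityʳ : ∀ p → p * 1# ≋ p
*-identityʳ p = ≋-trans (*-comm p 1#) (*-identityˡ p)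

*-distribˡ-+ : ∀ p q r → p * (q + r) ≋ p * q + p * r
*-distribˡ-+ p q r = begin
  p * (q + r)    ≈⟨ *-comm p (q + r) ⟩
  (q + r) * p    ≡⟨ *-distribʳ-+ p q r ⟩
  q * p + r * p  ≈⟨ +-cong (*-comm q p) (*-comm r p) ⟩
  p * q + p * r  ∎

Laurent-commutativeRing : CommutativeRing _ _
Laurent-commutativeRing = record
  { isCommutativeRing = record
    { isRing = record
      { +-isAbelianGroup = record
        { isGroup = record
          { isMonoid = record
            { isSemigroup = record
              { isMagma = record
                { isEquivalence = ≋-isEquivalence
                ; ∙-cong = +-cong
                }
              ; assoc = λ p q r → ≋-reflexive (++-assoc p q r)
              }
            ; identity = (λ _ → ≋-refl) , (λ p → ≋-reflexive (++-identityʳ p))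
            }
          ; inverse = (λ p → ≋-trans (+-comm (- p) p) (+-inverseʳ p)) , +-inverseʳ
          ; ⁻¹-cong = -‿cong
          }
        ; comm = +-comm
        }
      ; *-cong = *-cong
      ; *-assoc = λ p q r → ≋-reflexive (*-assoc p q r)
      ; *-identity = *-identityˡ , *-identityʳ
      ; distrib = *-distribˡ-+ , (λ p q r → ≋-reflexive (*-distribʳ-+ p q r))
      }
    ; *-comm = *-comm
    }
  }

-- The ring solver takes its coefficients from ℤ through this map. `con 1ℤ` means `1#` on the nose,
-- while the image of `0ℤ` is a list with one zero term and equals `0#` only up to `_≋_`.
constant-homo : ℤ.+-*-rawRing -Raw-AlmostCommutative⟶ fromCommutativeRing Laurent-commutativeRing
constant-homo = record
  { ⟦_⟧    = λ c → [ c , 0ℤ , 0ℤ ]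
  ; +-homo = λ c d → mk (+-homo c d)
  ; *-homo = λ _ _ → ≋-refl
  ; -‿homo = λ _ → ≋-refl
  ; 0-homo = mk 0-homo
  ; 1-homo = ≋-refl
  }
  where
  +-homo : ∀ c d → [ c ℤ.+ d , 0ℤ , 0ℤ ] ≈ [ c , 0ℤ , 0ℤ ] + [ d , 0ℤ , 0ℤ ]
  +-homo c d i j with 0ℤ ℤ.≟ i ×-dec 0ℤ ℤ.≟ j
  ... | yes _ = ℤ.+-assoc c d 0ℤ
  ... | no  _ = refl

  0-homo : [ 0ℤ , 0ℤ , 0ℤ ] ≈ 0#
  0-homo i j with 0ℤ ℤ.≟ i ×-dec 0ℤ ℤ.≟ j
  ... | yes _ = refl
  ... | no  _ = refl

constant-≟ : ∀ c d → Maybe ([ c , 0ℤ , 0ℤ ] ≋ [ d , 0ℤ , 0ℤ ])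
constant-≟ c d with c ℤ.≟ d
... | yes refl = just ≋-refl
... | no  _    = nothing

open import Algebra.Solver.Ring ℤ.+-*-rawRing (fromCommutativeRing Laurent-commutativeRing)
  constant-homo constant-≟
  using (solve; con; _:=_; _:+_; _:*_; _:-_; :-_)

-- Sums of Laurent polynomials over 𝔖 n

∑[_] : List B → (B → Laurent) → Laurent
∑[ xs ] f = sum (List.map f xs)

∑-cong : ∀ xs {f g : B → Laurent} → (∀ {x} → x ∈ xs → f x ≋ g x) → ∑[ xs ] f ≋ ∑[ xs ] g
∑-cong []       f≋g = ≋-refl
∑-cong (x ∷ xs) f≋g = +-cong (f≋g (here refl)) (∑-cong xs (f≋g ∘ there))

∑-+ : ∀ xs (f g : B → Laurent) → ∑[ xs ] (λ x → f x + g x) ≋ ∑[ xs ] f + ∑[ xs ] g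
∑-+ []       f g = ≋-refl
∑-+ (x ∷ xs) f g = begin
  f x + g x + ∑[ xs ] (λ y → f y + g y)    ≈⟨ +-cong ≋-refl (∑-+ xs f g) ⟩
  f x + g x + (∑[ xs ] f + ∑[ xs ] g)
    ≈⟨ solve 4 (λ a b c d → a :+ b :+ (c :+ d) := a :+ c :+ (b :+ d)) ≋-refl (f x) (g x) (∑[ xs ] f) (∑[ xs ] g) ⟩
  f x + ∑[ xs ] f + (g x + ∑[ xs ] g)      ∎

∑-* : ∀ xs p (f : B → Laurent) → ∑[ xs ] (λ x → p * f x) ≋ p * ∑[ xs ] f
∑-* []       p f = ≋-reflexive (sym (*-zeroʳ p))
∑-* (x ∷ xs) p f = ≋-trans (+-cong ≋-refl (∑-* xs p f)) (≋-sym (*-distribˡ-+ p (f x) (∑[ xs ] f)))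

∑-↭ : ∀ {xs ys} (f : B → Laurent) → xs ↭ ys → ∑[ xs ] f ≋ ∑[ ys ] f
∑-↭ f ↭.refl             = ≋-refl
∑-↭ f (↭.prep x p)       = +-cong {f x} ≋-refl (∑-↭ f p)
∑-↭ {xs = x ∷ y ∷ xs} {y ∷ x ∷ ys} f (↭.swap x y p) = begin
  f x + (f y + ∑[ xs ] f)    ≈⟨ +-cong {f x} ≋-refl (+-cong {f y} ≋-refl (∑-↭ f p)) ⟩
  f x + (f y + ∑[ ys ] f)
    ≈⟨ solve 3 (λ a b c → a :+ (b :+ c) := b :+ (a :+ c)) ≋-refl (f x) (f y) (∑[ ys ] f) ⟩
  f y + (f x + ∑[ ys ] f)   ∎
∑-↭ f (↭.trans p q)      = ≋-trans (∑-↭ f p) (∑-↭ f q)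

∑-map : ∀ xs (g : B → C) (f : C → Laurent) → ∑[ List.map g xs ] f ≋ ∑[ xs ] (f ∘ g)
∑-map xs g f = ≋-reflexive (cong sum (sym (map-∘ xs)))

module Constant = _-Raw-AlmostCommutative⟶_ constant-homo

number : ℕ → Laurent
number k = [ + k , 0ℤ , 0ℤ ]

number-+ : ∀ k l → number (k ℕ.+ l) ≋ number k + number l
number-+ k l = Constant.+-homo (+ k) (+ l)

∑-filter : ∀ {P : Pred B 0ℓ} (P? : Decidable P) xs (f : B → Laurent) →
  ∑[ xs ] (λ x → f x * number ⟦ P? x ⟧) ≋ ∑[ List.filter P? xs ] f
∑-filter P? []       f = ≋-refl
∑-filter P? (x ∷ xs) f with P? x
... | yes _ = +-cong (solve 1 (λ p → p :* con 1ℤ := p) ≋-refl (f x)) (∑-filter P? xs f)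
... | no  _ = +-cong {p′ = 0#}
  (≋-trans (*-congˡ (f x) Constant.0-homo) (≋-reflexive (*-zeroʳ (f x)))) (∑-filter P? xs f)

-- This is tⁿ Aₙ(s,1/t); see Ã≋tⁿ*A[1/t].
Ã : ℕ → Laurent
Ã n = ∑[ 𝔖 n ] (λ π → s^ (+ des π) * t^ (+ wexcF (lookup π)))

∑-relabel : ∀ (g h : Perm.Permutation′ n) (f : Vec (Fin n) n → Laurent) →
  ∑[ 𝔖 n ] (f ∘ relabel g h) ≋ ∑[ 𝔖 n ] f
∑-relabel {n} g h f = ≋-trans (≋-sym (∑-map (𝔖 n) (relabel g h) f)) (∑-↭ f (𝔖-relabel-↭ g h))

∑-first : ∀ x (f : Vec (Fin (suc m)) (suc m) → Laurent) →
  ∑[ 𝔖 (suc m) ] (λ σ → f σ * number ⟦ first≟ x σ ⟧) ≋ ∑[ 𝔖 m ] (f ∘ prepend x)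
∑-first {m} x f = begin
  ∑[ 𝔖 (suc m) ] (λ σ → f σ * number ⟦ first≟ x σ ⟧)  ≈⟨ ∑-filter (first≟ x) (𝔖 (suc m)) f ⟩
  ∑[ List.filter (first≟ x) (𝔖 (suc m)) ] f           ≈⟨ ∑-↭ f (𝔖-prepend-↭ x) ⟨
  ∑[ List.map (prepend x) (𝔖 m) ] f                   ≈⟨ ∑-map (𝔖 m) (prepend x) f ⟩
  ∑[ 𝔖 m ] (f ∘ prepend x)                            ∎

-- `s^ (+ suc i)` computes to `s * s^ (+ i)`, and likewise for `t`, so only a rearrangement of
-- factors remains.
monomial-suc-suc : ∀ i j → s^ (+ suc i) * t^ (+ suc j) ≋ s * t * (s^ (+ i) * t^ (+ j))
monomial-suc-suc i j = solve 4 (λ s t S T → (s :* S) :* (t :* T) := s :* t :* (S :* T)) ≋-refl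
  s t (s^ (+ i)) (t^ (+ j))

-- s^(1-ε) = s - (s - 1) ε for a bit ε.
s-shift : ∀ {P : Set} (p? : Dec P) k →
  s * s^ (+ k) ≋ s^ (+ (⟦ p? ⟧ ℕ.+ k)) * (s - (s - 1#) * number ⟦ p? ⟧)
s-shift (yes _) k = solve 2 (λ s S → s :* S := (s :* S) :* (s :- (s :- con 1ℤ) :* con 1ℤ)) ≋-refl s (s^ (+ k))
s-shift (no  _) k = solve 2 (λ s S → s :* S := S :* (s :- (s :- con 1ℤ) :* con 0ℤ)) ≋-refl s (s^ (+ k))

-- The identity for Ãₙ - t Aₙ with n ≥ 2.

module _ (m : ℕ) where
  private
    N : ℕ
    N = suc (suc m)

    Word : Set
    Word = Vec (Fin N) N

  weight : Word → Laurent
  weight σ = s^ (+ cdesF (lookup σ)) * t^ (+ wexcF (lookup σ))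

  -- For a bit `q` this is the sum of the weights of the words where `q` is 1. Admitting any `q`
  -- into ℕ allows identities between sums of bits to be applied word by word.
  weighted : (Word → ℕ) → Laurent
  weighted q = ∑[ 𝔖 N ] (λ σ → weight σ * number (q σ))

  weighted-cong : {q r : Word → ℕ} → (∀ σ → q σ ≡ r σ) → weighted q ≋ weighted r
  weighted-cong q≡r = ∑-cong (𝔖 N) (λ {σ} _ → ≋-reflexive (cong (λ k → weight σ * number k) (q≡r σ)))

  weighted-+ : (q r : Word → ℕ) →
    weighted (λ σ → q σ ℕ.+ r σ) ≋ weighted q + weighted r
  weighted-+ q r = ≋-trans
    (∑-cong (𝔖 N) (λ {σ} _ → ≋-trans (*-congˡ (weight σ) (number-+ (q σ) (r σ)))
                                          (*-distribˡ-+ (weight σ) (number (q σ)) (number (r σ)))))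
    (∑-+ (𝔖 N) (λ σ → weight σ * number (q σ)) (λ σ → weight σ * number (r σ)))

  conjugate : Word → Word
  conjugate = relabel (flip cycle) cycle

  lookup-conjugate : (σ : Word) → ∀ i → lookup (conjugate σ) i ≡ conj (lookup σ) i
  lookup-conjugate = lookup-relabel (flip cycle) cycle

  weight-conjugate : ∀ {σ} → σ ∈ 𝔖 N → weight (conjugate σ) ≡ weight σ
  weight-conjugate {σ = σ} σ∈𝔖 = cong₂ (λ i j → s^ (+ i) * t^ (+ j))
    (trans (sum-cong-≗ (λ i → cong₂ (λ a b → ⟦ a Fin.<? b ⟧)
             (lookup-conjugate σ i) (lookup-conjugate σ (prev i))))
           (cdesF-conj (lookup σ)))
    (trans (sum-cong-≗ (λ i → cong (λ a → ⟦ i Fin.≤? a ⟧) (lookup-conjugate σ i)))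
           (wexcF-conj (∈-𝔖⁻ σ∈𝔖)))

  weighted-conjugate : (q : Word → ℕ) → weighted (q ∘ conjugate) ≋ weighted q
  weighted-conjugate q = ≋-trans
    (∑-cong (𝔖 N) (λ {σ} σ∈𝔖 →
      ≋-reflexive (cong (_* number (q (conjugate σ))) (sym (weight-conjugate σ∈𝔖)))))
    (∑-relabel (flip cycle) cycle (λ σ → weight σ * number (q σ)))

  -- The bits for σₙ > σ₁ and σ₁ > σ₂, by which `cdesF` exceeds the descent numbers of σ₁...σₙ and
  -- of σ₂...σₙσ₁ respectively.
  wrapAsc startDes : Word → ℕ
  wrapAsc  σ = ⟦ lookup σ zero Fin.<? lookup σ (fromℕ (suc m)) ⟧
  startDes σ = ⟦ lookup σ (suc zero) Fin.<? lookup σ zero ⟧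

  -- The conjugate begins with `prev` of σ₂ and ends with `prev` of σ₁, so this is an instance of
  -- `prev-⟦<⟧`.
  wrapAsc-conjugate : (σ : Word) →
    wrapAsc (conjugate σ) ℕ.+ ⟦ lookup σ (suc zero) Fin.≟ zero ⟧ ≡ startDes σ ℕ.+ ⟦ first≟ zero σ ⟧
  wrapAsc-conjugate σ = trans
    (cong (λ k → k ℕ.+ ⟦ lookup σ (suc zero) Fin.≟ zero ⟧)
      (cong₂ (λ a b → ⟦ a Fin.<? b ⟧)
        (trans (lookup-conjugate σ zero) (cong (prev ∘ lookup σ) (next-inject₁ zero)))
        (trans (lookup-conjugate σ (fromℕ (suc m))) (cong (prev ∘ lookup σ) (next-fromℕ (suc m))))))
    (prev-⟦<⟧ (lookup σ (suc zero)) (lookup σ zero))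

  first-conjugate : (σ : Word) →
    ⟦ first≟ (fromℕ (suc m)) (conjugate σ) ⟧ ≡ ⟦ lookup σ (suc zero) Fin.≟ zero ⟧
  first-conjugate σ = ⟦⟧-cong (first≟ (fromℕ (suc m)) (conjugate σ)) (lookup σ (suc zero) Fin.≟ zero)
    (λ eq → prev≡fromℕ _ (trans (sym first) eq))
    (λ eq → trans first (cong prev eq))
    where
    first : lookup (conjugate σ) zero ≡ prev (lookup σ (suc zero))
    first = trans (lookup-conjugate σ zero) (cong (prev ∘ lookup σ) (next-inject₁ zero))

  -- Sum `wrapAsc-conjugate` against the weights. Conjugation keeps the weights and turns σ₂ = 1
  -- into σ₁ = n. Both sides are sums because the bits live in ℕ.
  weighted-balance :
    weighted wrapAsc + weighted (λ σ → ⟦ first≟ (fromℕ (suc m)) σ ⟧) ≋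
    weighted startDes + weighted (λ σ → ⟦ first≟ zero σ ⟧)
  weighted-balance = begin
    weighted wrapAsc + weighted (λ σ → ⟦ first≟ (fromℕ (suc m)) σ ⟧)
      ≈⟨ +-cong (weighted-conjugate wrapAsc) (weighted-conjugate (λ σ → ⟦ first≟ (fromℕ (suc m)) σ ⟧)) ⟨
    weighted (wrapAsc ∘ conjugate) + weighted (λ σ → ⟦ first≟ (fromℕ (suc m)) (conjugate σ) ⟧)
      ≈⟨ +-cong ≋-refl (weighted-cong first-conjugate) ⟩
    weighted (wrapAsc ∘ conjugate) + weighted (λ σ → ⟦ lookup σ (suc zero) Fin.≟ zero ⟧)
      ≈⟨ weighted-+ (wrapAsc ∘ conjugate) (λ σ → ⟦ lookup σ (suc zero) Fin.≟ zero ⟧) ⟨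
    weighted (λ σ → wrapAsc (conjugate σ) ℕ.+ ⟦ lookup σ (suc zero) Fin.≟ zero ⟧)
      ≈⟨ weighted-cong wrapAsc-conjugate ⟩
    weighted (λ σ → startDes σ ℕ.+ ⟦ first≟ zero σ ⟧)
      ≈⟨ weighted-+ startDes (λ σ → ⟦ first≟ zero σ ⟧) ⟩
    weighted startDes + weighted (λ σ → ⟦ first≟ zero σ ⟧) ∎

  weighted-first-fromℕ : weighted (λ σ → ⟦ first≟ (fromℕ (suc m)) σ ⟧) ≋ s * t * A (suc m)
  weighted-first-fromℕ = begin
    weighted (λ σ → ⟦ first≟ (fromℕ (suc m)) σ ⟧)
      ≈⟨ ∑-first (fromℕ (suc m)) weight ⟩
    ∑[ 𝔖 (suc m) ] (weight ∘ prepend (fromℕ (suc m)))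
      ≈⟨ ∑-cong (𝔖 (suc m)) (λ {τ} _ → ≋-trans
           (≋-reflexive (cong₂ (λ i j → s^ (+ i) * t^ (+ j))
             (trans (cdesF-prepend-fromℕ τ) (cong suc (sym (des≡desF τ))))
             (trans (wexcF-prepend-fromℕ τ) (cong suc (sym (exc≡excF τ))))))
           (monomial-suc-suc (des τ) (exc τ))) ⟩
    ∑[ 𝔖 (suc m) ] (λ τ → s * t * (s^ (+ des τ) * t^ (+ exc τ)))
      ≈⟨ ∑-* (𝔖 (suc m)) (s * t) (λ τ → s^ (+ des τ) * t^ (+ exc τ)) ⟩
    s * t * A (suc m) ∎

  weighted-first-zero : weighted (λ σ → ⟦ first≟ zero σ ⟧) ≋ s * t * Ã (suc m)
  weighted-first-zero = begin
    weighted (λ σ → ⟦ first≟ zero σ ⟧)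
      ≈⟨ ∑-first zero weight ⟩
    ∑[ 𝔖 (suc m) ] (weight ∘ prepend zero)
      ≈⟨ ∑-cong (𝔖 (suc m)) (λ {τ} _ → ≋-trans
           (≋-reflexive (cong₂ (λ i j → s^ (+ i) * t^ (+ j))
             (trans (cdesF-prepend-zero τ) (cong suc (sym (des≡desF τ))))
             (wexcF-prepend-zero τ)))
           (monomial-suc-suc (des τ) (wexcF (lookup τ)))) ⟩
    ∑[ 𝔖 (suc m) ] (λ τ → s * t * (s^ (+ des τ) * t^ (+ wexcF (lookup τ))))
      ≈⟨ ∑-* (𝔖 (suc m)) (s * t) (λ τ → s^ (+ des τ) * t^ (+ wexcF (lookup τ))) ⟩
    s * t * Ã (suc m) ∎

  -- Here `d` is an exponent lying below `cdesF` by the bit `q`. It is applied to both Ãₙ and t Aₙ,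
  -- so that the common term `s * ∑[ 𝔖 N ] weight` cancels in their difference.
  s-multiple : ∀ (q d : Word → ℕ) →
    (∀ σ → s * s^ (+ d σ) ≋ s^ (+ cdesF (lookup σ)) * (s - (s - 1#) * number (q σ))) →
    s * ∑[ 𝔖 N ] (λ σ → s^ (+ d σ) * t^ (+ wexcF (lookup σ))) ≋
    s * ∑[ 𝔖 N ] weight - (s - 1#) * weighted q
  s-multiple q d shift = begin
    s * ∑[ 𝔖 N ] f
      ≈⟨ ∑-* (𝔖 N) s f ⟨
    ∑[ 𝔖 N ] (λ σ → s * f σ)
      ≈⟨ ∑-cong (𝔖 N) (λ {σ} _ → lem σ) ⟩
    -- The subtraction is written as a multiple by `- (s - 1#)`, so that `∑-+` and `∑-*` apply.
    ∑[ 𝔖 N ] (λ σ → s * weight σ + - (s - 1#) * (weight σ * number (q σ)))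
      ≈⟨ ∑-+ (𝔖 N) (λ σ → s * weight σ) (λ σ → - (s - 1#) * (weight σ * number (q σ))) ⟩
    ∑[ 𝔖 N ] (λ σ → s * weight σ) + ∑[ 𝔖 N ] (λ σ → - (s - 1#) * (weight σ * number (q σ)))
      ≈⟨ +-cong (∑-* (𝔖 N) s weight) (∑-* (𝔖 N) (- (s - 1#)) (λ σ → weight σ * number (q σ))) ⟩
    s * ∑[ 𝔖 N ] weight + - (s - 1#) * weighted q
      ≈⟨ solve 3 (λ s W Q → s :* W :+ :- (s :- con 1ℤ) :* Q := s :* W :- (s :- con 1ℤ) :* Q) ≋-refl
           s (∑[ 𝔖 N ] weight) (weighted q) ⟩
    s * ∑[ 𝔖 N ] weight - (s - 1#) * weighted q ∎
    where
    f : Word → Laurent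
    f σ = s^ (+ d σ) * t^ (+ wexcF (lookup σ))

    lem : ∀ σ → s * f σ ≋ s * weight σ + - (s - 1#) * (weight σ * number (q σ))
    lem σ = begin
      s * (s^ (+ d σ) * T)
        ≡⟨ *-assoc s (s^ (+ d σ)) T ⟨
      s * s^ (+ d σ) * T
        ≈⟨ *-cong (shift σ) (≋-refl {T}) ⟩
      S * (s - (s - 1#) * number (q σ)) * T
        ≈⟨ solve 4 (λ s S T Q → S :* (s :- (s :- con 1ℤ) :* Q) :* T
                     := s :* (S :* T) :+ :- (s :- con 1ℤ) :* ((S :* T) :* Q)) ≋-refl s S T (number (q σ)) ⟩
      s * weight σ + - (s - 1#) * (weight σ * number (q σ)) ∎
      where
      S T : Laurent
      S = s^ (+ cdesF (lookup σ))
      T = t^ (+ wexcF (lookup σ))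

  rotate : Word → Word
  rotate = relabel Perm.id (flip cycle)

  -- Substitute σ = `rotate π` = πₙπ₁...πₙ₋₁. Then `next` undoes the rotation inside `desF`, and the
  -- weak excedances of σ number `suc (exc π)`, which absorbs the factor t.
  t*A : t * A N ≋
    ∑[ 𝔖 N ] (λ σ → s^ (+ desF (lookup σ ∘ next)) * t^ (+ wexcF (lookup σ)))
  t*A = begin
    t * A N
      ≈⟨ ∑-* (𝔖 N) t (λ π → s^ (+ des π) * t^ (+ exc π)) ⟨
    ∑[ 𝔖 N ] (λ π → t * (s^ (+ des π) * t^ (+ exc π)))
      ≈⟨ ∑-cong (𝔖 N) (λ {π} _ → lem π) ⟩
    ∑[ 𝔖 N ] (f ∘ rotate)
      ≈⟨ ∑-relabel Perm.id (flip cycle) f ⟩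
    ∑[ 𝔖 N ] f ∎
    where
    f : Word → Laurent
    f σ = s^ (+ desF (lookup σ ∘ next)) * t^ (+ wexcF (lookup σ))

    lookup-rotate : ∀ π i → lookup (rotate π) i ≡ lookup π (prev i)
    lookup-rotate = lookup-relabel Perm.id (flip cycle)

    desF-rotate : ∀ π → desF (lookup (rotate π) ∘ next) ≡ des π
    desF-rotate π = trans
      (sum-cong-≗ (λ i → cong₂ (λ a b → ⟦ a Fin.<? b ⟧) (unrotate (suc i)) (unrotate (inject₁ i))))
      (sym (des≡desF π))
      where
      unrotate : ∀ i → lookup (rotate π) (next i) ≡ lookup π i
      unrotate i = trans (lookup-rotate π (next i)) (cong (lookup π) (prev-next i))

    wexcF-rotated : ∀ π → wexcF (lookup (rotate π)) ≡ suc (exc π)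
    wexcF-rotated π = trans
      (sum-cong-≗ (λ i → cong (λ a → ⟦ i Fin.≤? a ⟧) (lookup-rotate π i)))
      (trans (wexcF-rotate (lookup π)) (cong suc (sym (exc≡excF π))))

    lem : ∀ π → t * (s^ (+ des π) * t^ (+ exc π)) ≋ f (rotate π)
    lem π = begin
      t * (s^ (+ des π) * t^ (+ exc π))
        ≈⟨ solve 3 (λ t S T → t :* (S :* T) := S :* (t :* T)) ≋-refl t (s^ (+ des π)) (t^ (+ exc π)) ⟩
      s^ (+ des π) * t^ (+ suc (exc π))
        ≡⟨ cong₂ (λ i j → s^ (+ i) * t^ (+ j)) (desF-rotate π) (wexcF-rotated π) ⟨
      f (rotate π) ∎

  Ã-tA : Ã N - t * A N ≋ (s - 1#) * t * (A (suc m) - Ã (suc m))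
  Ã-tA = cancel-s (begin
    s * (Ã N - t * A N)
      ≈⟨ *-distribˡ-- s (Ã N) (t * A N) ⟩
    s * Ã N - s * (t * A N)
      ≈⟨ +-cong (≋-trans (*-congˡ s Ã-des) (s-multiple wrapAsc (desF ∘ lookup) shift₁))
                (-‿cong (≋-trans (*-congˡ s t*A)
                                 (s-multiple startDes (λ σ → desF (lookup σ ∘ next)) shift₂))) ⟩
    (s * W - (s - 1#) * weighted wrapAsc) - (s * W - (s - 1#) * weighted startDes)
      ≈⟨ solve 4 (λ s W X Y → (s :* W :- (s :- con 1ℤ) :* X) :- (s :* W :- (s :- con 1ℤ) :* Y)
                   := (s :- con 1ℤ) :* (Y :- X)) ≋-refl s W (weighted wrapAsc) (weighted startDes) ⟩
    (s - 1#) * (weighted startDes - weighted wrapAsc)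
      ≈⟨ *-congˡ (s - 1#) difference ⟩
    (s - 1#) * (s * t * A (suc m) - s * t * Ã (suc m))
      ≈⟨ solve 4 (λ s t X Y → (s :- con 1ℤ) :* (s :* t :* X :- s :* t :* Y)
                   := s :* ((s :- con 1ℤ) :* t :* (X :- Y))) ≋-refl s t (A (suc m)) (Ã (suc m)) ⟩
    s * ((s - 1#) * t * (A (suc m) - Ã (suc m))) ∎)
    where
    W : Laurent
    W = ∑[ 𝔖 N ] weight

    *-distribˡ-- : ∀ p q r → p * (q - r) ≋ p * q - p * r
    *-distribˡ-- = solve 3 (λ p q r → p :* (q :- r) := p :* q :- p :* r) ≋-refl

    cancel-s : ∀ {p q} → s * p ≋ s * q → p ≋ q
    cancel-s {p} {q} sp≋sq = begin
      -- s is a unit among Laurent polynomials: `s^ (ℤ.- + 1) * s` computes to `1#`.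
      p                        ≈⟨ *-identityˡ p ⟨
      s^ (ℤ.- + 1) * s * p     ≡⟨ *-assoc (s^ (ℤ.- + 1)) s p ⟩
      s^ (ℤ.- + 1) * (s * p)   ≈⟨ *-congˡ (s^ (ℤ.- + 1)) sp≋sq ⟩
      s^ (ℤ.- + 1) * (s * q)   ≡⟨ *-assoc (s^ (ℤ.- + 1)) s q ⟨
      s^ (ℤ.- + 1) * s * q     ≈⟨ *-identityˡ q ⟩
      q                        ∎

    Ã-des : Ã N ≋ ∑[ 𝔖 N ] (λ σ → s^ (+ desF (lookup σ)) * t^ (+ wexcF (lookup σ)))
    Ã-des = ∑-cong (𝔖 N) (λ {σ} _ →
      ≋-reflexive (cong (λ d → s^ (+ d) * t^ (+ wexcF (lookup σ))) (des≡desF σ)))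

    shift₁ : ∀ σ → s * s^ (+ desF (lookup σ)) ≋
      s^ (+ cdesF (lookup σ)) * (s - (s - 1#) * number (wrapAsc σ))
    shift₁ σ = s-shift (lookup σ zero Fin.<? lookup σ (fromℕ (suc m))) (desF (lookup σ))

    shift₂ : ∀ σ → s * s^ (+ desF (lookup σ ∘ next)) ≋
      s^ (+ cdesF (lookup σ)) * (s - (s - 1#) * number (startDes σ))
    shift₂ σ = ≋-trans
      (s-shift (lookup σ (suc zero) Fin.<? lookup σ zero) (desF (lookup σ ∘ next)))
      (≋-reflexive (cong (λ c → s^ (+ c) * (s - (s - 1#) * number (startDes σ))) (desF-next (lookup σ))))

    difference : weighted startDes - weighted wrapAsc ≋ s * t * A (suc m) - s * t * Ã (suc m)
    difference = begin
      weighted startDes - weighted wrapAsc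
        -- The weight of the words with σ₁ = 1 is added and subtracted, to make the right side of
        -- `weighted-balance` appear.
        ≈⟨ solve 3 (λ x y z → x :- y := (x :+ z) :- y :- z) ≋-refl
             (weighted startDes) (weighted wrapAsc) (weighted first-zero) ⟩
      weighted startDes + weighted first-zero - weighted wrapAsc - weighted first-zero
        ≈⟨ +-cong (+-cong weighted-balance ≋-refl) ≋-refl ⟨
      weighted wrapAsc + weighted first-last - weighted wrapAsc - weighted first-zero
        ≈⟨ solve 3 (λ x y z → x :+ y :- x :- z := y :- z) ≋-refl
             (weighted wrapAsc) (weighted first-last) (weighted first-zero) ⟩
      weighted first-last - weighted first-zero
        ≈⟨ +-cong weighted-first-fromℕ (-‿cong weighted-first-zero) ⟩
      s * t * A (suc m) - s * t * Ã (suc m) ∎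
      where
      first-last first-zero : Word → ℕ
      first-last σ = ⟦ first≟ (fromℕ (suc m)) σ ⟧
      first-zero σ = ⟦ first≟ zero σ ⟧

-- The reversed polynomial tⁿ Aₙ(s,1/t) and the recurrence.

nonexc : Vec (Fin n) n → ℕ
nonexc π = nonexcF (lookup π)

∑-inv : ∀ xs (f : B → Laurent) → (∑[ xs ] f) [1/t] ≡ ∑[ xs ] (λ x → f x [1/t])
∑-inv []       f = refl
∑-inv (x ∷ xs) f = trans (map-++ invₜ (f x) (∑[ xs ] f)) (cong (_+_ (f x [1/t])) (∑-inv xs f))

neg-inv : ∀ p → (- p) [1/t] ≡ - (p [1/t])
neg-inv p = trans (sym (map-∘ p)) (map-∘ p)

+[m+n]-m : ∀ k l → + (k ℕ.+ l) ℤ.- + k ≡ + l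
+[m+n]-m k l = trans (ℤ.m-n≡m⊖n (k ℕ.+ l) k) (trans (ℤ.⊖-≥ (ℕ.m≤m+n k l)) (cong +_ (ℕ.m+n∸m≡n k l)))

-- By `excF+nonexcF`, n minus the number of excedances is `nonexc`.
tⁿ*A[1/t] : ∀ n → t^ (+ n) * A n [1/t] ≋ ∑[ 𝔖 n ] (λ π → s^ (+ des π) * t^ (+ nonexc π))
tⁿ*A[1/t] n = begin
  t^ (+ n) * A n [1/t]
    ≡⟨ cong (t^ (+ n) *_) (∑-inv (𝔖 n) (λ π → s^ (+ des π) * t^ (+ exc π))) ⟩
  t^ (+ n) * ∑[ 𝔖 n ] (λ π → (s^ (+ des π) * t^ (+ exc π)) [1/t])
    ≈⟨ ∑-* (𝔖 n) (t^ (+ n)) (λ π → (s^ (+ des π) * t^ (+ exc π)) [1/t]) ⟨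
  ∑[ 𝔖 n ] (λ π → t^ (+ n) * (s^ (+ des π) * t^ (+ exc π)) [1/t])
    ≈⟨ ∑-cong (𝔖 n) (λ {π} _ → lem π) ⟩
  ∑[ 𝔖 n ] (λ π → s^ (+ des π) * t^ (+ nonexc π)) ∎
  where
  exponent : ∀ (π : Vec (Fin n) n) → + n ℤ.- + exc π ≡ + nonexc π
  exponent π = trans (cong (λ k → + k ℤ.- + exc π) (sym (trans (cong (ℕ._+ nonexc π) (exc≡excF π))
    (excF+nonexcF (lookup π))))) (+[m+n]-m (exc π) (nonexc π))

  lem : ∀ π → t^ (+ n) * (s^ (+ des π) * t^ (+ exc π)) [1/t] ≋ s^ (+ des π) * t^ (+ nonexc π)
  lem π = begin
    t^ (+ n) * (s^ (+ des π) * t^ (+ exc π)) [1/t]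
      ≡⟨ cong (t^ (+ n) *_) (inv-* (s^ (+ des π)) (t^ (+ exc π))) ⟩
    t^ (+ n) * (s^ (+ des π) * t^ (ℤ.- + exc π))
      ≈⟨ solve 3 (λ t S T → t :* (S :* T) := S :* (t :* T)) ≋-refl
           (t^ (+ n)) (s^ (+ des π)) (t^ (ℤ.- + exc π)) ⟩
    s^ (+ des π) * t^ (+ n ℤ.- + exc π)
      ≡⟨ cong (λ k → s^ (+ des π) * t^ k) (exponent π) ⟩
    s^ (+ des π) * t^ (+ nonexc π) ∎

-- Reverse-complementation keeps the descent number and carries `wexcF` to `nonexc`.
Ã≋tⁿ*A[1/t] : ∀ m → Ã (suc m) ≋ t^ (+ suc m) * A (suc m) [1/t]
Ã≋tⁿ*A[1/t] m = begin
  Ã (suc m)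
    ≈⟨ ∑-relabel {suc m} Perm.reverse Perm.reverse (λ π → s^ (+ des π) * t^ (+ wexcF (lookup π))) ⟨
  ∑[ 𝔖 (suc m) ] (λ π → s^ (+ des (rc π)) * t^ (+ wexcF (lookup (rc π))))
    ≈⟨ ∑-cong (𝔖 (suc m)) (λ {π} _ →
         ≋-reflexive (cong₂ (λ i j → s^ (+ i) * t^ (+ j)) (des-rc π) (wexcF-rc π))) ⟩
  ∑[ 𝔖 (suc m) ] (λ π → s^ (+ des π) * t^ (+ nonexc π))
    ≈⟨ tⁿ*A[1/t] (suc m) ⟨
  t^ (+ suc m) * A (suc m) [1/t] ∎
  where
  rc : Vec (Fin (suc m)) (suc m) → Vec (Fin (suc m)) (suc m)
  rc = relabel Perm.reverse Perm.reverse

  lookup-rc : ∀ π i → lookup (rc π) i ≡ opposite (lookup π (opposite i))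
  lookup-rc = lookup-relabel Perm.reverse Perm.reverse

  des-rc : ∀ π → des (rc π) ≡ des π
  des-rc π = trans (des≡desF (rc π)) (trans
    (sum-cong-≗ (λ i → cong₂ (λ a b → ⟦ a Fin.<? b ⟧) (lookup-rc π (suc i)) (lookup-rc π (inject₁ i))))
    (trans (desF-reverse-complement (lookup π)) (sym (des≡desF π))))

  wexcF-rc : ∀ π → wexcF (lookup (rc π)) ≡ nonexc π
  wexcF-rc π = trans
    (sum-cong-≗ (λ i → cong (λ a → ⟦ i Fin.≤? a ⟧) (lookup-rc π i)))
    (wexcF-reverse-complement (lookup π))

-- num (a m) is A m - t^ (+ m) * A m [1/t], except that it is 0# for m = 0.
recurrence : ∀ m → t^ (+ suc m) * A (suc m) [1/t] - t * A (suc m) ≋ (s - 1#) * t * num (a m)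
-- `A 1` evaluates to `1#`, so the left side computes to `t - t`.
recurrence zero = ≋-trans (+-inverseʳ t) (≋-reflexive (sym (*-zeroʳ ((s - 1#) * t))))
recurrence (suc m) = begin
  t^ (+ suc (suc m)) * A (suc (suc m)) [1/t] - t * A (suc (suc m))
    ≈⟨ +-cong (Ã≋tⁿ*A[1/t] (suc m)) ≋-refl ⟨
  Ã (suc (suc m)) - t * A (suc (suc m))
    ≈⟨ Ã-tA m ⟩
  (s - 1#) * t * (A (suc m) - Ã (suc m))
    ≈⟨ *-congˡ ((s - 1#) * t) (+-cong {A (suc m)} ≋-refl (-‿cong (Ã≋tⁿ*A[1/t] m))) ⟩
  (s - 1#) * t * num (a (suc m)) ∎

-- Polynomiality.

NonNegative : Term → Set
NonNegative (c , i , j) = 0ℤ ℤ.≤ i × 0ℤ ℤ.≤ j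

-- A nonzero coefficient must come from some listed term. The converse can fail, since terms with
-- negative exponents may cancel.
nonNegative⇒polynomial : ∀ {p} → All NonNegative p → IsPolynomial p
nonNegative⇒polynomial []                                      i j c≢0 = contradiction refl c≢0
nonNegative⇒polynomial {(c , a , b) ∷ p} ((0≤a , 0≤b) ∷ p≥0) i j c≢0 with a ℤ.≟ i ×-dec b ℤ.≟ j
... | yes (refl , refl) = 0≤a , 0≤b
... | no  _             = nonNegative⇒polynomial p≥0 i j (c≢0 ∘ trans (ℤ.+-identityˡ _))

nonNegative-neg : ∀ {p} → All NonNegative p → All NonNegative (- p)
nonNegative-neg = All.map⁺ ∘ All.map (λ 0≤ → 0≤)

nonNegative-* : ∀ {p q} → All NonNegative p → All NonNegative q → All NonNegative (p * q)
nonNegative-* []                  q≥0 = []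
nonNegative-* ((0≤a , 0≤b) ∷ p≥0) q≥0 = All.++⁺
  (All.map⁺ (All.map (λ (0≤a′ , 0≤b′) → ℤ.+-mono-≤ 0≤a 0≤a′ , ℤ.+-mono-≤ 0≤b 0≤b′) q≥0))
  (nonNegative-* p≥0 q≥0)

nonNegative-∑ : ∀ xs {f : B → Laurent} → (∀ x → All NonNegative (f x)) → All NonNegative (∑[ xs ] f)
nonNegative-∑ []       f≥0 = []
nonNegative-∑ (x ∷ xs) f≥0 = All.++⁺ (f≥0 x) (nonNegative-∑ xs f≥0)

0≤+ : ∀ {k} → 0ℤ ℤ.≤ + k
0≤+ = ℤ.+≤+ z≤n

-- The polynomial 1 + t + ... + tᵏ⁻¹, that is (1 - tᵏ)/(1 - t).
geometric : ℕ → Laurent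
geometric zero    = 0#
geometric (suc k) = geometric k + t^ (+ k)

geometric-nonNegative : ∀ k → All NonNegative (geometric k)
geometric-nonNegative zero    = []
geometric-nonNegative (suc k) = All.++⁺ (geometric-nonNegative k) ((0≤+ , 0≤+) ∷ [])

geometric-sum : ∀ k → geometric k * (1# - t) ≋ 1# - t^ (+ k)
geometric-sum zero    = ≋-sym (+-inverseʳ 1#)
geometric-sum (suc k) = begin
  (geometric k + t^ (+ k)) * (1# - t)
    ≡⟨ *-distribʳ-+ (1# - t) (geometric k) (t^ (+ k)) ⟩
  geometric k * (1# - t) + t^ (+ k) * (1# - t)
    ≈⟨ +-cong (geometric-sum k) ≋-refl ⟩
  1# - t^ (+ k) + t^ (+ k) * (1# - t)
    ≈⟨ solve 2 (λ t T → con 1ℤ :- T :+ T :* (con 1ℤ :- t) := con 1ℤ :- t :* T) ≋-refl t (t^ (+ k)) ⟩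
  1# - t^ (+ suc k) ∎

-- tᵉ - tⁿ⁻ᵉ = (1 - t) (geometric (n - e) - geometric e), applied to each permutation
a-quotient : ℕ → Laurent
a-quotient n = ∑[ 𝔖 n ] (λ π → s^ (+ des π) * (geometric (nonexc π) - geometric (exc π)))

a-quotient-nonNegative : ∀ n → All NonNegative (a-quotient n)
a-quotient-nonNegative n = nonNegative-∑ (𝔖 n) (λ π → nonNegative-* {s^ (+ des π)} ((0≤+ , 0≤+) ∷ [])
  (All.++⁺ (geometric-nonNegative (nonexc π)) (nonNegative-neg (geometric-nonNegative (exc π)))))

a-quotient-correct : ∀ n → A n - t^ (+ n) * A n [1/t] ≋ a-quotient n * (1# - t)
a-quotient-correct n = begin
  A n - t^ (+ n) * A n [1/t]
    ≈⟨ +-cong {A n} ≋-refl (-‿cong (tⁿ*A[1/t] n)) ⟩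
  A n - ∑[ 𝔖 n ] (λ π → s^ (+ des π) * t^ (+ nonexc π))
    ≈⟨ solve 2 (λ x y → x :- y := x :+ :- con 1ℤ :* y) ≋-refl (A n) (∑[ 𝔖 n ] (λ π → s^ (+ des π) * t^ (+ nonexc π))) ⟩
  A n + - 1# * ∑[ 𝔖 n ] (λ π → s^ (+ des π) * t^ (+ nonexc π))
    ≈⟨ +-cong {A n} ≋-refl (∑-* (𝔖 n) (- 1#) (λ π → s^ (+ des π) * t^ (+ nonexc π))) ⟨
  A n + ∑[ 𝔖 n ] (λ π → - 1# * (s^ (+ des π) * t^ (+ nonexc π)))
    ≈⟨ ∑-+ (𝔖 n) (λ π → s^ (+ des π) * t^ (+ exc π)) (λ π → - 1# * (s^ (+ des π) * t^ (+ nonexc π))) ⟨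
  ∑[ 𝔖 n ] (λ π → s^ (+ des π) * t^ (+ exc π) + - 1# * (s^ (+ des π) * t^ (+ nonexc π)))
    ≈⟨ ∑-cong (𝔖 n) (λ {π} _ → lem π) ⟩
  ∑[ 𝔖 n ] (λ π → (1# - t) * (s^ (+ des π) * (geometric (nonexc π) - geometric (exc π))))
    ≈⟨ ∑-* (𝔖 n) (1# - t) (λ π → s^ (+ des π) * (geometric (nonexc π) - geometric (exc π))) ⟩
  (1# - t) * a-quotient n
    ≈⟨ *-comm (1# - t) (a-quotient n) ⟩
  a-quotient n * (1# - t) ∎
  where
  lem : ∀ π → s^ (+ des π) * t^ (+ exc π) + - 1# * (s^ (+ des π) * t^ (+ nonexc π)) ≋
              (1# - t) * (s^ (+ des π) * (geometric (nonexc π) - geometric (exc π)))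
  lem π = begin
    S * t^ (+ exc π) + - 1# * (S * t^ (+ nonexc π))
      -- Writing tᵉ - tⁿ⁻ᵉ as (1 - tⁿ⁻ᵉ) - (1 - tᵉ) makes each bracket a geometric sum times 1 - t.
      ≈⟨ solve 3 (λ S E N → S :* E :+ :- con 1ℤ :* (S :* N)
                   := S :* ((con 1ℤ :- N) :- (con 1ℤ :- E))) ≋-refl S (t^ (+ exc π)) (t^ (+ nonexc π)) ⟩
    S * ((1# - t^ (+ nonexc π)) - (1# - t^ (+ exc π)))
      ≈⟨ *-congˡ S (+-cong (geometric-sum (nonexc π)) (-‿cong (geometric-sum (exc π)))) ⟨
    S * (geometric (nonexc π) * (1# - t) - geometric (exc π) * (1# - t))
      ≈⟨ solve 4 (λ S t N E → S :* (N :* (con 1ℤ :- t) :- E :* (con 1ℤ :- t))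
                   := (con 1ℤ :- t) :* (S :* (N :- E))) ≋-refl S t (geometric (nonexc π)) (geometric (exc π)) ⟩
    (1# - t) * (S * (geometric (nonexc π) - geometric (exc π))) ∎
    where
    S : Laurent
    S = s^ (+ des π)

a-polynomial : ∀ n → IsPolynomialᶠ (a n)
a-polynomial zero      = 0# , nonNegative⇒polynomial [] , λ _ _ → refl
a-polynomial n@(suc _) = a-quotient n , nonNegative⇒polynomial (a-quotient-nonNegative n) ,
  coeffwise (≋-trans (*-identityʳ (num (a n))) (a-quotient-correct n))

[s-1]a-polynomial : ∀ n → IsPolynomialᶠ (ι (s - 1#) *ᶠ a n)
[s-1]a-polynomial zero      = 0# , nonNegative⇒polynomial [] , λ _ _ → refl
[s-1]a-polynomial n@(suc _) = (s - 1#) * a-quotient n ,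
  nonNegative⇒polynomial (nonNegative-* {s - 1#} ((0≤+ , 0≤+) ∷ (0≤+ , 0≤+) ∷ []) (a-quotient-nonNegative n)) ,
  coeffwise (begin
    (s - 1#) * num (a n) * 1#
      ≈⟨ *-identityʳ ((s - 1#) * num (a n)) ⟩
    (s - 1#) * num (a n)
      ≈⟨ *-congˡ (s - 1#) (a-quotient-correct n) ⟩
    (s - 1#) * (a-quotient n * (1# - t))
      ≈⟨ solve 3 (λ s q t → (s :- con 1ℤ) :* (q :* (con 1ℤ :- t))
                   := (s :- con 1ℤ) :* q :* (con 1ℤ :* (con 1ℤ :- t))) ≋-refl s (a-quotient n) t ⟩
    (s - 1#) * a-quotient n * (1# * (1# - t)) ∎)

-- Symmetry in t and the decomposition.

a-symmetric : ∀ n → TSymmetric (+ n ℤ.- + 1) (a n)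
a-symmetric zero      = λ _ _ → refl
a-symmetric n@(suc _) = coeffwise (begin
  -- `T * V` is tⁿ⁻¹ by computation, and the inverted denominator is `1# - V`.
  T * V * (A n - T * A n [1/t]) [1/t] * (1# - t)
    ≡⟨ cong (λ p → T * V * p * (1# - t)) num-inv ⟩
  T * V * (Ā - U * A n) * (1# - t)
    ≈⟨ solve 6 (λ T U t V X Y → T :* V :* (Y :- U :* X) :* (con 1ℤ :- t)
         := T :* V :* Y :- T :* (t :* V) :* Y :- V :* (T :* U) :* X :+ (T :* U) :* (t :* V) :* X)
         ≋-refl T U t V (A n) Ā ⟩
  T * V * Ā - T * (t * V) * Ā - V * (T * U) * A n + (T * U) * (t * V) * A n
    -- `t * V` computes to `1#`; the product `T * U` involves the variable n and needs the inverse
    -- law.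
    ≡⟨ cong (λ p → T * V * Ā - T * 1# * Ā - V * p * A n + p * 1# * A n) T*U ⟩
  T * V * Ā - T * 1# * Ā - V * 1# * A n + 1# * 1# * A n
    ≈⟨ solve 4 (λ T V X Y → T :* V :* Y :- T :* con 1ℤ :* Y :- V :* con 1ℤ :* X :+ con 1ℤ :* con 1ℤ :* X
         := (X :- T :* Y) :* (con 1ℤ :* (con 1ℤ :- V))) ≋-refl T V (A n) Ā ⟩
  (A n - T * Ā) * (1# * (1# - V)) ∎)
  where
  T U V Ā : Laurent
  T = t^ (+ n)
  U = t^ (ℤ.- + n)
  V = t^ (ℤ.- + 1)
  Ā = A n [1/t]

  T*U : T * U ≡ 1#
  T*U = cong t^_ (ℤ.+-inverseʳ (+ n))

  num-inv : (A n - T * Ā) [1/t] ≡ Ā - U * A n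
  num-inv = trans (map-++ invₜ (A n) (- (T * Ā))) (cong (_+_ Ā)
    (trans (neg-inv (T * Ā)) (cong -_ (trans (inv-* T Ā) (cong (_*_ U) (inv-involutive (A n)))))))

-- A factor fixed by t ↦ 1/t passes through the inversion, so the exponent `k` is unchanged. It is
-- applied to `s - 1#`.
scale-symmetric : ∀ {k} p f → p [1/t] ≡ p → TSymmetric k f → TSymmetric k (ι p *ᶠ f)
scale-symmetric {k} p f p-inv f-symmetric = coeffwise (begin
  t^ k * (p * num f) [1/t] * (1# * den f)
    ≡⟨ cong (λ q → t^ k * q * (1# * den f)) (trans (inv-* p (num f)) (cong (_* num f [1/t]) p-inv)) ⟩
  t^ k * (p * num f [1/t]) * (1# * den f)
    ≈⟨ solve 4 (λ K p N D → K :* (p :* N) :* (con 1ℤ :* D) := p :* (K :* N :* D)) ≋-refl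
         (t^ k) p (num f [1/t]) (den f) ⟩
  p * (t^ k * num f [1/t] * den f)
    ≈⟨ *-congˡ p (mk f-symmetric) ⟩
  p * (num f * (1# * den f [1/t]))
    ≈⟨ solve 3 (λ p N D → p :* (N :* (con 1ℤ :* D)) := p :* N :* (con 1ℤ :* (con 1ℤ :* D))) ≋-refl
         p (num f) (den f [1/t]) ⟩
  p * num f * (1# * (1# * den f [1/t]))
    ≡⟨ cong (λ q → p * num f * (1# * q)) (inv-* 1# (den f)) ⟨
  p * num f * (1# * (1# * den f) [1/t]) ∎)

a-decomposes : ∀ m → ι (A (suc m)) ≃ a (suc m) +ᶠ ι t *ᶠ (ι (s - 1#) *ᶠ a m)
a-decomposes m = coeffwise (begin
  A N * ((1# - t) * (1# * (1# * D)))
    -- (1 - t) Aₙ splits into the numerator of aₙ and the left side of `recurrence`.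
    ≈⟨ solve 4 (λ X Y t D → X :* ((con 1ℤ :- t) :* (con 1ℤ :* (con 1ℤ :* D)))
         := ((X :- Y) :+ (Y :- t :* X)) :* D) ≋-refl (A N) TĀ t D ⟩
  ((A N - TĀ) + (TĀ - t * A N)) * D
    ≈⟨ *-cong (+-cong {A N - TĀ} ≋-refl (recurrence m)) ≋-refl ⟩
  ((A N - TĀ) + (s - 1#) * t * num (a m)) * D
    ≈⟨ solve 5 (λ X s t Y D → (X :+ (s :- con 1ℤ) :* t :* Y) :* D
         := X :* D :+ (s :- con 1ℤ) :* t :* (Y :* D)) ≋-refl (A N - TĀ) s t (num (a m)) D ⟩
  (A N - TĀ) * D + (s - 1#) * t * (num (a m) * D)
    ≈⟨ +-cong {(A N - TĀ) * D} ≋-refl (*-congˡ ((s - 1#) * t) (num*den m)) ⟩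
  (A N - TĀ) * D + (s - 1#) * t * (num (a m) * (1# - t))
    ≈⟨ solve 5 (λ X s t Y D → X :* D :+ (s :- con 1ℤ) :* t :* (Y :* (con 1ℤ :- t))
         := (X :* (con 1ℤ :* (con 1ℤ :* D)) :+ t :* ((s :- con 1ℤ) :* Y) :* (con 1ℤ :- t)) :* con 1ℤ)
         ≋-refl (A N - TĀ) s t (num (a m)) D ⟩
  ((A N - TĀ) * (1# * (1# * D)) + t * ((s - 1#) * num (a m)) * (1# - t)) * 1# ∎)
  where
  N : ℕ
  N = suc m

  D TĀ : Laurent
  D  = den (a m)
  TĀ = t^ (+ N) * A N [1/t]

  -- The denominators differ for m = 0, but then the numerator is 0#.
  num*den : ∀ m → num (a m) * den (a m) ≋ num (a m) * (1# - t)
  num*den zero    = ≋-refl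
  num*den (suc _) = ≋-refl

theorem4 : ∀ (n : ℕ) → 1 ≤ n →
    IsPolynomialᶠ (a n)
    × TSymmetric (+ n -ℤ + 1) (a n)
    × TSymmetricDecomposition n (ι (A n)) (a n) (ι (s - 1#) *ᶠ a (n ∸ 1))
theorem4 n@(suc m) _ = a-polynomial n , a-symmetric n , record
  { f-polynomial = a-polynomial n
  ; f-symmetric  = a-symmetric n
  ; g-polynomial = [s-1]a-polynomial m
  -- The center of symmetry is that of aₙ₋₁, whose exponent (n - 1) - 1 is n - 2; `refl` suffices
  -- because s - 1 does not contain t.
  ; g-symmetric  = scale-symmetric {+ n -ℤ + 2} (s - 1#) (a m) refl
      (subst (λ k → TSymmetric k (a m)) exponent (a-symmetric m))
  ; decomposes   = a-decomposes m
  }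
  where
  exponent : + m -ℤ + 1 ≡ + n -ℤ + 2
  exponent = trans (ℤ.m-n≡m⊖n m 1) (sym (trans (ℤ.m-n≡m⊖n n 2) (ℤ.[1+m]⊖[1+n]≡m⊖n m 1)))
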